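{- Let $r,n$ be positive integers and $\epsilon\in\{1,-1\}$. Then the following identities of polynomials in $q$ hold. (i) For any $w\in S_n$, $$\sum_{\pi\in G^*_{r,n}(w)}\epsilon^{\mathrm{inv}(|\pi|)}q^{\mathrm{Dmaj}(\pi)}=\epsilon^{\mathrm{inv}(w)}q^{\mathrm{maj}(w)}\cdot[r]_{q}[r]_{q^2}\cdots[r]_{q^{n-1}}.$$ (ii) $$\sum_{\pi\in G^*_{r,n}}\epsilon^{\mathrm{inv}(|\pi|)}q^{\mathrm{Dmaj}(\pi)}=[r]_{q}[2r]_{\epsilon q}\cdots[(n-1)r]_{\epsilon^{n}q}\,[n]_{\epsilon^{n-1}q},$$ where for $1\le i\le n-1$ the $i$th factor is $[ir]_{\epsilon^{i-1}q}$ (note $\epsilon^{n}=\epsilon^{n-2}$) and the last factor is $[n]_{\epsilon^{n-1}q}$.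
   Context: Here $q$ is an indeterminate and $[m]_x:=1+x+\cdots+x^{m-1}$ for an integer $m\ge 0$. Empty products equal $1$. $G_{r,n}=\mathbb{Z}_r\wr S_n$ is the group of colored permutations: its elements are $\pi=(\pi_1,\dots,\pi_n)=(\sigma_1^{z_1},\dots,\sigma_n^{z_n})$ with $\sigma=(\sigma_1,\dots,\sigma_n)\in S_n$ (one-line notation) and colors $z_i\in\{0,\dots,r-1\}$. Write $|\pi|=\sigma$, $|\pi_i|=\sigma_i$ (regarded as a colored integer of color $0$), and $\mathrm{col}(\pi)=z_1+\cdots+z_n$ (sum of integers). A colored integer of color $0$ is written without exponent. For $\sigma\in S_n$, $\mathrm{inv}(\sigma)=\#\{i<j:\sigma_i>\sigma_j\}$ and $\mathrm{maj}(\sigma)=\sum_{i:\sigma_i>\sigma_{i+1}}i$. Colored integers are compared in the linear order $$1^{r-1}<\cdots<n^{r-1}<\cdots<1^1<\cdots<n^1<1<\cdots<n.$$ With this order, $\mathrm{maj}_F(\pi)=\sum_{1\le i\le n-1,\ \pi_i>\pi_{i+1}}i$ and $\mathrm{fmaj}(\pi)=r\cdot\mathrm{maj}_F(\pi)+\mathrm{col}(\pi)$. $G^*_{r,n}=\{\pi\in G_{r,n}:\mathrm{col}(\pi)\equiv 0\pmod r\}$, and for $w\in S_n$, $G^*_{r,n}(w)=\{\pi\in G^*_{r,n}:|\pi|=w\}$. For $\pi\in G^*_{r,n}$, $\mathrm{Dmaj}(\pi):=\mathrm{fmaj}\big((\pi_1,\dots,\pi_{n-1},|\pi_n|)\big)$.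 -}

module Defs where

open import Algebra.Bundles using (RawSemiring)
import Algebra.Definitions.RawSemiring as RawSemiringDefs
open import Data.Bool.Base using (if_then_else_)
open import Data.Fin.Base as Fin using (Fin; toℕ; fromℕ<)
import Data.Fin.Properties as Fin
open import Data.Integer.Base as ℤ using (ℤ; 0ℤ; 1ℤ)
open import Data.List.Base as List using (List; []; _∷_)
open import Data.Nat.Base as ℕ using (ℕ; zero; suc; NonZero)
open import Data.Nat.Divisibility using (_∣_; _∣?_)
import Data.Nat.Properties as ℕ
open import Data.Product.Base using (_×_; _,_; proj₁; proj₂)
open import Data.Sum.Base using (_⊎_)
open import Data.Vec.Base as Vec using (Vec; []; _∷_)
open import Data.Vec.Properties using (≡-dec)
open import Data.Vec.Relation.Unary.AllPairs using (allPairs?)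
open import Data.Vec.Relation.Unary.Unique.Propositional using (Unique)
open import Level using (0ℓ)
open import Relation.Binary.Core using (Rel)
open import Relation.Binary.Definitions using (Decidable)
open import Relation.Binary.PropositionalEquality.Core using (_≡_)
open import Relation.Nullary.Decidable.Core using (does; ¬?; _×-dec_; _⊎-dec_)
import Relation.Unary as U

-- Polynomials over ℤ as coefficient lists, constant term first. Trailing zeros are allowed, so
-- equality of polynomials is _≈_ (equality of all coefficients), not _≡_.
Poly : Set
Poly = List ℤ

coeff : Poly → ℕ → ℤ
coeff []      k       = 0ℤ
coeff (a ∷ f) zero    = a
coeff (a ∷ f) (suc k) = coeff f k

infix 4 _≈_
_≈_ : Poly → Poly → Set
f ≈ g = ∀ k → coeff f k ≡ coeff g k

infixl 6 _+_
_+_ : Poly → Poly → Poly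
[]      + g       = g
(a ∷ f) + []      = a ∷ f
(a ∷ f) + (b ∷ g) = (a ℤ.+ b) ∷ (f + g)

infixl 7 _*_
_*_ : Poly → Poly → Poly
[]      * g = []
(a ∷ f) * g = List.map (a ℤ.*_) g + (0ℤ ∷ f * g)

const : ℤ → Poly
const a = a ∷ []

q : Poly
q = 0ℤ ∷ 1ℤ ∷ []

ℤ[q] : RawSemiring 0ℓ 0ℓ
ℤ[q] = record
  { Carrier = Poly
  ; _≈_     = _≈_
  ; _+_     = _+_
  ; _*_     = _*_
  ; 0#      = []
  ; 1#      = const 1ℤ
  }

open RawSemiringDefs ℤ[q] public using (_^_; sum; product)

[_]⟨_⟩ : ℕ → Poly → Poly
[ m ]⟨ x ⟩ = sum {m} λ k → x ^ toℕ k

∑ : ∀ {a} {A : Set a} → List A → (A → Poly) → Poly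
∑ xs f = List.foldr (λ x s → f x + s) [] xs

-- Repetition-free if as is, so the lists G, G* and G*⟨ w ⟩ below contain
-- each element of the corresponding finite set exactly once.
vectors : ∀ {a} {A : Set a} → List A → (m : ℕ) → List (Vec A m)
vectors as zero    = [] ∷ []
vectors as (suc m) = List.cartesianProductWith _∷_ as (vectors as m)

module _ {a ℓ} {A : Set a} {_<_ : Rel A ℓ} (_<?_ : Decidable _<_) where

  invBy : ∀ {m} → Vec A m → ℕ
  invBy []       = 0
  invBy (x ∷ xs) = Vec.count (_<? x) xs ℕ.+ invBy xs

  -- The sum of the descent positions, the first entry having position i.
  majFrom : ℕ → ∀ {m} → Vec A m → ℕ
  majFrom i []           = 0
  majFrom i (x ∷ [])     = 0
  majFrom i (x ∷ y ∷ xs) =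
    (if does (y <? x) then i else 0) ℕ.+ majFrom (suc i) (y ∷ xs)

  majBy : ∀ {m} → Vec A m → ℕ
  majBy = majFrom 1

-- Permutations of {1,…,n} are words in one-line notation with distinct
-- entries; the letter k ∈ {1,…,n} is represented by the element k − 1 of
-- Fin n.
inv maj : ∀ {n m} → Vec (Fin n) m → ℕ
inv = invBy Fin._<?_
maj = majBy Fin._<?_

IsPermutation : ∀ {n} → Vec (Fin n) n → Set
IsPermutation = Unique

isPermutation? : ∀ {n} → U.Decidable (IsPermutation {n})
isPermutation? = allPairs? λ i j → ¬? (i Fin.≟ j)

-- The colored integer i^z is the pair (i , z).
Colored : ℕ → ℕ → Set
Colored r n = Fin n × Fin r

letter : ∀ {r n} → Colored r n → Fin n
letter = proj₁

color : ∀ {r n} → Colored r n → Fin r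
color = proj₂

-- Larger colors come first:
-- 1^{r-1} < ⋯ < n^{r-1} < ⋯ < 1^1 < ⋯ < n^1 < 1 < ⋯ < n.
infix 4 _⊏_ _⊏?_
_⊏_ : ∀ {r n} → Rel (Colored r n) 0ℓ
x ⊏ y = color y Fin.< color x
      ⊎ (color x ≡ color y × letter x Fin.< letter y)

_⊏?_ : ∀ {r n} → Decidable (_⊏_ {r} {n})
x ⊏? y = (color y Fin.<? color x)
   ⊎-dec ((color x Fin.≟ color y) ×-dec (letter x Fin.<? letter y))

∣_∣ : ∀ {r n m} → Vec (Colored r n) m → Vec (Fin n) m
∣ π ∣ = Vec.map letter π

col : ∀ {r n m} → Vec (Colored r n) m → ℕ
col π = Vec.sum (Vec.map (λ x → toℕ (color x)) π)

fmaj : ∀ {r n m} → Vec (Colored r n) m → ℕ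
fmaj {r} π = r ℕ.* majBy _⊏?_ π ℕ.+ col π

module _ {r : ℕ} .{{_ : NonZero r}} {n : ℕ} where

  uncolor : Colored r n → Colored r n
  uncolor (i , _) = i , fromℕ< (ℕ.>-nonZero⁻¹ r)

  uncolorLast : ∀ {m} → Vec (Colored r n) m → Vec (Colored r n) m
  uncolorLast []           = []
  uncolorLast (x ∷ [])     = uncolor x ∷ []
  uncolorLast (x ∷ y ∷ xs) = x ∷ uncolorLast (y ∷ xs)

  Dmaj : ∀ {m} → Vec (Colored r n) m → ℕ
  Dmaj π = fmaj (uncolorLast π)

G : (r n : ℕ) → List (Vec (Colored r n) n)
G r n = List.filter (λ π → isPermutation? ∣ π ∣)
          (vectors (List.cartesianProduct (List.allFin n) (List.allFin r)) n)

G* : (r n : ℕ) → List (Vec (Colored r n) n)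
G* r n = List.filter (λ π → r ∣? col π) (G r n)

-- G*_{r,n}(w) is G*⟨ w ⟩ r.
G*⟨_⟩ : ∀ {n} → Vec (Fin n) n → (r : ℕ) → List (Vec (Colored r n) n)
G*⟨_⟩ {n} w r = List.filter (λ π → ≡-dec Fin._≟_ ∣ π ∣ w) (G* r n)

{-# OPTIONS --safe #-}
module Submission where

-- Let c(i) be the difference of the i-th and (i+1)-st colors, increased by r at a descent. As the
-- last color is 0, fmaj is the sum of the i c(i). Once the later colors are fixed, the i-th color
-- runs through 0, …, r − 1 exactly when c(i) runs through r consecutive integers, starting at 1 or
-- 0 according to whether w has a descent at i or not. This gives (i).
--
-- By (i), and since [i r]_y = [i]_y [r]_{y^i} with y^i = q^i for y = ε^{i-1} q, (ii) reduces to the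
-- Gessel–Simion formula: the sum of ε^inv q^maj over S_n is the product of the [i]_{ε^{i-1} q}.
-- More generally, sum ε^inv(u) q^maj(u a) over the arrangements u of a set of k letters, j of them
-- greater than a, for a letter a outside the set: the result is (ε^{k-1} q)^j times the product of
-- the first k factors, by induction on k, separating the last letter of u.

open import Defs hiding (_≈_; _+_; _*_; _^_; sum; product; ∑)
open import Algebra.Bundles using (CommutativeMonoid; CommutativeSemiring)
import Algebra.Definitions.RawSemiring as RawSemiringDefs
import Algebra.Properties.CommutativeMonoid.Sum as MonoidSum
import Algebra.Properties.CommutativeSemigroup as CommutativeSemigroupProperties
import Algebra.Properties.CommutativeSemiring.Exp as Exp
import Algebra.Properties.Semiring.Exp as SemiringExp
import Algebra.Properties.Semiring.Sum as SemiringSum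
import Algebra.Solver.Ring.NaturalCoefficients.Default as RingSolver
open import Algebra.Structures.Biased using (isCommutativeSemiringˡ)
open import Data.Bool.Base using (Bool; true; false; not; _∧_; _∨_; if_then_else_)
import Data.Bool.Properties as Bool
open import Data.Fin.Base as Fin using (Fin; toℕ; fromℕ<; zero; suc)
import Data.Fin.Properties as Fin
open import Data.Integer.Base as ℤ using (ℤ; 0ℤ; 1ℤ; -1ℤ)
import Data.Integer.Properties as ℤ
import Data.Integer.Tactic.RingSolver as ℤ
open import Data.List.Base as List using (List; []; _∷_; _++_)
open import Data.Nat.Base as ℕ
  using (ℕ; zero; suc; _∸_; NonZero; _≤_; _<_; z<s; s<s; s≤s; _<ᵇ_; _≡ᵇ_)
import Data.Nat.Divisibility as ℕ
open import Data.Nat.Divisibility using (_∣?_)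
import Data.Nat.Properties as ℕ
import Data.Nat.Tactic.RingSolver as ℕ
open import Data.Product.Base using (_×_; _,_)
open import Data.Sum.Base using (_⊎_; inj₁; inj₂)
open import Data.Vec.Base as Vec using (Vec; []; _∷_; _∷ʳ_)
open import Data.Vec.Properties using (≡-dec)
import Data.Vec.Relation.Unary.All as All
open import Data.Vec.Relation.Unary.AllPairs using (allPairs?)
open import Function.Base using (_∘_)
open import Function.Bundles using (mk⇔)
open import Level using (Level; 0ℓ)
open import Relation.Binary.Definitions using (tri<; tri≈; tri>)
open import Relation.Binary.Structures using (IsEquivalence)
import Relation.Binary.PropositionalEquality as ≡
open import Relation.Binary.PropositionalEquality.Core using (_≡_)
open import Relation.Nullary.Decidable using (does; does-⇔; dec-true; dec-false; ¬?)
open import Relation.Nullary.Negation using (contradiction)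
import Relation.Unary as U

module Words where
  open import Data.Nat.Base using (_+_; _*_)
  open ≡ using (refl; sym; trans; cong; cong₂; module ≡-Reasoning)
  module ∧ = CommutativeSemigroupProperties
    (CommutativeMonoid.commutativeSemigroup Bool.∧-commutativeMonoid)

  private variable
    r n m : ℕ

  -- Descents and color gaps.

  toNat : Bool → ℕ
  toNat b = if b then 1 else 0

  -- For consecutive letters of colors z and c; b tells whether the uncolored letters form a descent.
  isDescent : Bool → ℕ → ℕ → Bool
  isDescent b z c = (z <ᵇ c) ∨ ((c ≡ᵇ z) ∧ b)

  isDescent-< : ∀ b {z c} → z < c → isDescent b z c ≡ true
  isDescent-< b z<s       = refl
  isDescent-< b (s<s z<c@(s≤s _)) = isDescent-< b z<c

  isDescent-refl : ∀ b c → isDescent b c c ≡ b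
  isDescent-refl b zero    = refl
  isDescent-refl b (suc c) = isDescent-refl b c

  isDescent-> : ∀ b c k → isDescent b (c + suc k) c ≡ false
  isDescent-> b zero    k = refl
  isDescent-> b (suc c) k = isDescent-> b c k

  does-≟ : (i j : Fin r) → does (i Fin.≟ j) ≡ (toℕ i ≡ᵇ toℕ j)
  does-≟ zero    zero    = refl
  does-≟ zero    (suc j) = refl
  does-≟ (suc i) zero    = refl
  does-≟ (suc i) (suc j) = does-≟ i j

  does-⊏? : (x y : Fin n) (z c : Fin r) →
    does (_⊏?_ {r} {n} (y , c) (x , z)) ≡ isDescent (does (y Fin.<? x)) (toℕ z) (toℕ c)
  does-⊏? x y z c = cong (λ b → (toℕ z <ᵇ toℕ c) ∨ (b ∧ does (y Fin.<? x))) (does-≟ c z)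

  -- The number c(i) for consecutive colors `z` and `c`. Truncated subtraction loses nothing for
  -- `c ≤ r`, as `colorGap+c` confirms.
  colorGap : ℕ → Bool → ℕ → ℕ → ℕ
  colorGap r b z c = z + (if isDescent b z c then r else 0) ∸ c

  -- With r = c + d and c < r, this case and the next two give the gaps d, ..., r - 1 for z < c,
  -- then 0 or r for z = c, then 1, ..., d - 1 for z > c.
  colorGap-< : ∀ b {z c d} → z < c → colorGap (c + d) b z c ≡ d + z
  colorGap-< b {z} {c} {d} z<c rewrite isDescent-< b z<c = begin
    z + (c + d) ∸ c  ≡⟨ cong (_∸ c) (lemma z c d) ⟩
    d + z + c ∸ c    ≡⟨ ℕ.m+n∸n≡m (d + z) c ⟩
    d + z            ∎
    where
    open ≡-Reasoning
    lemma : ∀ z c d → z + (c + d) ≡ d + z + c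
    lemma = ℕ.solve-∀

  colorGap-refl : ∀ r b c → colorGap r b c c ≡ (if b then r else 0)
  colorGap-refl r b c rewrite isDescent-refl b c = ℕ.m+n∸m≡n c _

  colorGap-> : ∀ r b c k → colorGap r b (c + suc k) c ≡ suc k
  colorGap-> r b c k rewrite isDescent-> b c k | ℕ.+-identityʳ (c + suc k) = ℕ.m+n∸m≡n c (suc k)

  -- Larger colors come first in the order, so a rise `z < c` of the color is always a descent, and
  -- its summand `r` covers `c`; otherwise `z` alone covers it.
  colorGap+c : ∀ r b z c → c ≤ r → colorGap r b z c + c ≡ z + (if isDescent b z c then r else 0)
  colorGap+c r b z c c≤r = ℕ.m∸n+n≡m (bound z c c≤r)
    where
    bound : ∀ z c → c ≤ r → c ≤ z + (if isDescent b z c then r else 0)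
    bound z c c≤r with ℕ.<-cmp z c
    ... | tri< z<c _ _ rewrite isDescent-< b z<c = ℕ.m≤n⇒m≤o+n z c≤r
    ... | tri≈ _ z≡c _ = ℕ.m≤n⇒m≤n+o _ (ℕ.≤-reflexive (sym z≡c))
    ... | tri> _ _ z>c = ℕ.m≤n⇒m≤n+o _ (ℕ.<⇒≤ z>c)

  -- For i = 0 this is fmaj. The first color is given weight i + 1 in place of 1: this is what
  -- remains of fmaj after i letters preceding π have been removed along with their color gaps.
  fmajFrom : ℕ → Vec (Colored r n) (suc m) → ℕ
  fmajFrom {r} i π = r * majFrom _⊏?_ (suc i) π + col π + i * toℕ (color (Vec.head π))

  -- One step of summation by parts. Color and descent at the first letter contribute `suc i` times
  -- (gap + next color); the share of the next color raises the weight of that color from 1 to i +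
  -- 2, which is `fmajFrom (suc i)`.
  fmajFrom-∷ : ∀ i (x y : Fin n) (w : Vec (Fin n) m) z (v : Vec (Fin r) (suc m)) →
    fmajFrom i (Vec.zip (x ∷ y ∷ w) (z ∷ v))
      ≡ suc i * colorGap r (does (y Fin.<? x)) (toℕ z) (toℕ (Vec.head v))
        + fmajFrom (suc i) (Vec.zip (y ∷ w) v)
  fmajFrom-∷ {r = r} i x y w z (c ∷ v) rewrite does-⊏? x y z c =
    regroup (isDescent (does (y Fin.<? x)) (toℕ z) (toℕ c))
      (majFrom _⊏?_ (suc (suc i)) (Vec.zip (y ∷ w) (c ∷ v)))
      (toℕ c) (col (Vec.zip w v)) (toℕ z) _
      (colorGap+c r (does (y Fin.<? x)) (toℕ z) (toℕ c) (ℕ.<⇒≤ (Fin.toℕ<n c)))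
    where
    open ≡-Reasoning
    expand : ∀ r i D M C S Z →
      r * (D + M) + (Z + (C + S)) + i * Z ≡ r * D + suc i * Z + (r * M + (C + S))
    expand = ℕ.solve-∀
    scale : ∀ b → r * (if b then suc i else 0) ≡ suc i * (if b then r else 0)
    scale true  = ℕ.*-comm r (suc i)
    scale false = trans (ℕ.*-zeroʳ r) (sym (ℕ.*-zeroʳ (suc i)))
    collect : ∀ i D Z → suc i * D + suc i * Z ≡ suc i * (Z + D)
    collect = ℕ.solve-∀
    split : ∀ i g C T → suc i * (g + C) + T ≡ suc i * g + (T + suc i * C)
    split = ℕ.solve-∀
    regroup : ∀ b M C S Z g → g + C ≡ Z + (if b then r else 0) →
      r * ((if b then suc i else 0) + M) + (Z + (C + S)) + i * Z
        ≡ suc i * g + (r * M + (C + S) + suc i * C)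
    regroup b M C S Z g gap = begin
      r * ((if b then suc i else 0) + M) + (Z + (C + S)) + i * Z           ≡⟨ expand r i (if b then suc i else 0) M C S Z ⟩
      r * (if b then suc i else 0) + suc i * Z + (r * M + (C + S))         ≡⟨ cong (λ t → t + suc i * Z + (r * M + (C + S))) (scale b) ⟩
      suc i * (if b then r else 0) + suc i * Z + (r * M + (C + S))         ≡⟨ cong (_+ (r * M + (C + S))) (collect i (if b then r else 0) Z) ⟩
      suc i * (Z + (if b then r else 0)) + (r * M + (C + S))               ≡⟨ cong (λ t → suc i * t + (r * M + (C + S))) gap ⟨
      suc i * (g + C) + (r * M + (C + S))                                  ≡⟨ split i g C _ ⟩
      suc i * g + (r * M + (C + S) + suc i * C)                            ∎

  -- Colored words as pairs of a word and a color vector.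

  ∣zip∣ : (w : Vec (Fin n) m) (z : Vec (Fin r) m) → ∣ Vec.zip w z ∣ ≡ w
  ∣zip∣ []      []      = refl
  ∣zip∣ (x ∷ w) (c ∷ z) = cong (x ∷_) (∣zip∣ w z)

  colors : Vec (Fin r) m → ℕ
  colors z = Vec.sum (Vec.map toℕ z)

  col-zip : (w : Vec (Fin n) m) (z : Vec (Fin r) m) → col (Vec.zip w z) ≡ colors z
  col-zip []      []      = refl
  col-zip (x ∷ w) (c ∷ z) = cong (toℕ c +_) (col-zip w z)

  colors-∷ʳ : (z : Vec (Fin r) m) (c : Fin r) → colors (z ∷ʳ c) ≡ colors z + toℕ c
  colors-∷ʳ []      c = ℕ.+-identityʳ _
  colors-∷ʳ (x ∷ z) c = trans (cong (toℕ x +_) (colors-∷ʳ z c)) (sym (ℕ.+-assoc (toℕ x) _ _))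

  -- Written as in `uncolor`, so that the two agree by `refl` at the last letter.
  colorZero : (r : ℕ) .{{_ : NonZero r}} → Fin r
  colorZero r = fromℕ< (ℕ.>-nonZero⁻¹ r)

  -- Consequently `Dmaj` does not see the last color, which remains free to meet the divisibility
  -- condition on the color sum.
  uncolorLast-zip : .{{_ : NonZero r}} (w : Vec (Fin n) (suc m)) (z : Vec (Fin r) m) (c : Fin r) →
    uncolorLast (Vec.zip w (z ∷ʳ c)) ≡ Vec.zip w (z ∷ʳ colorZero r)
  uncolorLast-zip (x ∷ [])    []          c = refl
  uncolorLast-zip (x ∷ y ∷ w) (a ∷ [])    c = cong ((x , a) ∷_) (uncolorLast-zip (y ∷ w) [] c)
  uncolorLast-zip (x ∷ y ∷ w) (a ∷ b ∷ z) c = cong ((x , a) ∷_) (uncolorLast-zip (y ∷ w) (b ∷ z) c)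

  -- Finite sets of letters as Boolean functions.

  cardinality : (Fin n → Bool) → ℕ
  cardinality {zero}  U = 0
  cardinality {suc n} U = toNat (U zero) + cardinality (U ∘ suc)

  infixl 6 _∖_
  _∖_ : (Fin n → Bool) → Fin n → Fin n → Bool
  (U ∖ a) x = U x ∧ not (does (a Fin.≟ x))

  cardinality-cong : {U V : Fin n → Bool} → (∀ x → U x ≡ V x) → cardinality U ≡ cardinality V
  cardinality-cong {zero}  U≗V = refl
  cardinality-cong {suc n} U≗V = cong₂ (λ b k → toNat b + k) (U≗V zero) (cardinality-cong (U≗V ∘ suc))

  cardinality-full : ∀ n → cardinality {n} (λ _ → true) ≡ n
  cardinality-full zero    = refl
  cardinality-full (suc n) = cong suc (cardinality-full n)

  cardinality-empty : ∀ n → cardinality {n} (λ _ → false) ≡ 0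
  cardinality-empty zero    = refl
  cardinality-empty (suc n) = cardinality-empty n

  -- The second set `Q` makes the lemma serve several counts: the size of `U` for constant `Q`, and
  -- the letters of `U` above a given one.
  cardinality-remove : (U Q : Fin n → Bool) {a : Fin n} → U a ≡ true →
    cardinality (λ x → U x ∧ Q x) ≡ toNat (Q a) + cardinality (λ x → (U ∖ a) x ∧ Q x)
  cardinality-remove {suc n} U Q {zero} Ua rewrite Ua =
    cong (toNat (Q zero) +_) (cardinality-cong λ x →
      cong (_∧ Q (suc x)) (sym (Bool.∧-identityʳ (U (suc x)))))
  cardinality-remove {suc n} U Q {suc a} Ua
    rewrite cardinality-remove (U ∘ suc) (Q ∘ suc) {a} Ua | Bool.∧-identityʳ (U zero) =
    swap (toNat (U zero ∧ Q zero)) (toNat (Q (suc a))) _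
    where
    swap : ∀ a b c → a + (b + c) ≡ b + (a + c)
    swap = ℕ.solve-∀

  cardinality-∖ : (U : Fin n → Bool) {a : Fin n} → U a ≡ true → cardinality U ≡ suc (cardinality (U ∖ a))
  cardinality-∖ U {a} Ua = begin
    cardinality U                              ≡⟨ cardinality-cong (λ x → Bool.∧-identityʳ (U x)) ⟨
    cardinality (λ x → U x ∧ true)             ≡⟨ cardinality-remove U (λ _ → true) Ua ⟩
    suc (cardinality (λ x → (U ∖ a) x ∧ true)) ≡⟨ cong suc (cardinality-cong (λ x → Bool.∧-identityʳ ((U ∖ a) x))) ⟩
    suc (cardinality (U ∖ a))                  ∎
    where open ≡-Reasoning

  cardinality-∧-≡0 : (U Q : Fin n → Bool) → cardinality U ≡ 0 → cardinality (λ x → U x ∧ Q x) ≡ 0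
  cardinality-∧-≡0 {zero}  U Q ∣U∣≡0 = refl
  cardinality-∧-≡0 {suc n} U Q ∣U∣≡0 with U zero
  ... | false = cardinality-∧-≡0 (U ∘ suc) (Q ∘ suc) ∣U∣≡0

  cardinality-split : (U Q : Fin n → Bool) →
    cardinality U ≡ cardinality (λ x → U x ∧ Q x) + cardinality (λ x → U x ∧ not (Q x))
  cardinality-split {zero}  U Q = refl
  cardinality-split {suc n} U Q with U zero | Q zero | cardinality-split (U ∘ suc) (Q ∘ suc)
  ... | false | _     | ih = ih
  ... | true  | true  | ih = cong suc ih
  ... | true  | false | ih = trans (cong suc ih) (sym (ℕ.+-suc _ _))

  -- Words with distinct letters from a given set.

  distinctIn : (Fin n → Bool) → Vec (Fin n) m → Bool
  distinctIn U []      = true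
  distinctIn U (x ∷ u) = U x ∧ distinctIn (U ∖ x) u

  distinctIn-cong : {U V : Fin n → Bool} → (∀ x → U x ≡ V x) → (u : Vec (Fin n) m) →
    distinctIn U u ≡ distinctIn V u
  distinctIn-cong U≗V []      = refl
  distinctIn-cong U≗V (x ∷ u) =
    cong₂ _∧_ (U≗V x) (distinctIn-cong (λ y → cong (_∧ not (does (x Fin.≟ y))) (U≗V y)) u)

  does-≟-sym : (i j : Fin n) → does (i Fin.≟ j) ≡ does (j Fin.≟ i)
  does-≟-sym i j = does-⇔ (mk⇔ sym sym) (i Fin.≟ j) (j Fin.≟ i)

  -- Removals of letters commute, so the last letter may be removed first. The induction over
  -- arrangements separates the last letter, while `distinctIn` recurses on the first.
  distinctIn-∷ʳ : (U : Fin n → Bool) (u : Vec (Fin n) m) (a : Fin n) →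
    distinctIn U (u ∷ʳ a) ≡ U a ∧ distinctIn (U ∖ a) u
  distinctIn-∷ʳ U []      a = refl
  distinctIn-∷ʳ U (x ∷ u) a = begin
    U x ∧ distinctIn (U ∖ x) (u ∷ʳ a)                           ≡⟨ cong (U x ∧_) (distinctIn-∷ʳ (U ∖ x) u a) ⟩
    U x ∧ ((U a ∧ not (does (x Fin.≟ a))) ∧ D (U ∖ x ∖ a))      ≡⟨ cong₂ (λ b d → U x ∧ ((U a ∧ not b) ∧ d)) (does-≟-sym x a)
                                                                     (distinctIn-cong (λ y → ∧.xy∙z≈xz∙y (U y) _ _) u) ⟩
    U x ∧ ((U a ∧ not (does (a Fin.≟ x))) ∧ D (U ∖ a ∖ x))      ≡⟨ cong (U x ∧_) (Bool.∧-assoc (U a) _ _) ⟩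
    U x ∧ (U a ∧ (not (does (a Fin.≟ x)) ∧ D (U ∖ a ∖ x)))      ≡⟨ ∧.x∙yz≈y∙xz (U x) (U a) _ ⟩
    U a ∧ (U x ∧ (not (does (a Fin.≟ x)) ∧ D (U ∖ a ∖ x)))      ≡⟨ cong (U a ∧_) (Bool.∧-assoc (U x) _ _) ⟨
    U a ∧ ((U x ∧ not (does (a Fin.≟ x))) ∧ D (U ∖ a ∖ x))      ∎
    where
    open ≡-Reasoning
    D : (Fin _ → Bool) → Bool
    D V = distinctIn V u

  allIn : (Fin n → Bool) → Vec (Fin n) m → Bool
  allIn U []      = true
  allIn U (x ∷ u) = U x ∧ allIn U u

  allIn-∖ : (U : Fin n → Bool) (x : Fin n) (u : Vec (Fin n) m) →
    allIn (U ∖ x) u ≡ allIn U u ∧ does (All.all? (λ y → ¬? (x Fin.≟ y)) u)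
  allIn-∖ U x []      = refl
  allIn-∖ U x (y ∷ u) rewrite allIn-∖ U x u = ∧.interchange (U y) _ _ _

  -- Moves the exclusion of earlier letters out of the shrinking set into pairwise inequality, the
  -- form in which `isPermutation?` decides distinctness.
  distinctIn-allIn : (U : Fin n → Bool) (u : Vec (Fin n) m) →
    distinctIn U u ≡ allIn U u ∧ does (allPairs? (λ i j → ¬? (i Fin.≟ j)) u)
  distinctIn-allIn U []      = refl
  distinctIn-allIn U (x ∷ u)
    rewrite distinctIn-allIn (U ∖ x) u | allIn-∖ U x u
          | Bool.∧-assoc (U x) (allIn U u) (does (All.all? (λ y → ¬? (x Fin.≟ y)) u)
              ∧ does (allPairs? (λ i j → ¬? (i Fin.≟ j)) u))
    = cong (U x ∧_) (Bool.∧-assoc (allIn U u) _ _)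

  allIn-full : (u : Vec (Fin n) m) → allIn (λ _ → true) u ≡ true
  allIn-full []      = refl
  allIn-full (x ∷ u) = allIn-full u

  isPermutation-distinctIn : (w : Vec (Fin n) n) → does (isPermutation? w) ≡ distinctIn (λ _ → true) w
  isPermutation-distinctIn w =
    sym (trans (distinctIn-allIn (λ _ → true) w) (cong (_∧ does (isPermutation? w)) (allIn-full w)))

  -- A word of |U| distinct letters from `U` uses up `U`, so its letters can be counted in the set.
  -- Thus the inversions made by an appended letter depend on the set alone, not on the arrangement.
  count-distinctIn : ∀ {p} {P : U.Pred (Fin n) p} (P? : U.Decidable P)
    (U : Fin n → Bool) (u : Vec (Fin n) m) → cardinality U ≡ m → distinctIn U u ≡ true →
    Vec.count P? u ≡ cardinality (λ x → U x ∧ does (P? x))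
  count-distinctIn P? U []      ∣U∣≡m d = sym (cardinality-∧-≡0 U (does ∘ P?) ∣U∣≡m)
  count-distinctIn P? U (x ∷ u) ∣U∣≡m d with U x in Ux
  ... | true
    rewrite cardinality-remove U (does ∘ P?) Ux
          | sym (count-distinctIn P? (U ∖ x) u (ℕ.suc-injective (trans (sym (cardinality-∖ U Ux)) ∣U∣≡m)) d)
    with does (P? x)
  ...   | true  = refl
  ...   | false = refl

  -- Inversions and major index of a word with a letter appended.

  count-∷ʳ : ∀ {p} {P : U.Pred (Fin n) p} (P? : U.Decidable P) (u : Vec (Fin n) m) a →
    Vec.count P? (u ∷ʳ a) ≡ Vec.count P? u + toNat (does (P? a))
  count-∷ʳ P? []      a with does (P? a)
  ... | true  = refl
  ... | false = refl
  count-∷ʳ P? (x ∷ u) a with does (P? x)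
  ... | true  = cong suc (count-∷ʳ P? u a)
  ... | false = count-∷ʳ P? u a

  count-∷ : ∀ {p} {P : U.Pred (Fin n) p} (P? : U.Decidable P) a (u : Vec (Fin n) m) →
    Vec.count P? (a ∷ u) ≡ toNat (does (P? a)) + Vec.count P? u
  count-∷ P? a u with does (P? a)
  ... | true  = refl
  ... | false = refl

  -- `inv` counts inversions by their left letter; here those whose right letter is the new last one
  -- are collected.
  inv-∷ʳ : (u : Vec (Fin n) m) (a : Fin n) → inv (u ∷ʳ a) ≡ Vec.count (a Fin.<?_) u + inv u
  inv-∷ʳ []      a = refl
  inv-∷ʳ (x ∷ u) a
    rewrite count-∷ʳ (Fin._<? x) u a | inv-∷ʳ u a | count-∷ (a Fin.<?_) x u =
    lemma (Vec.count (Fin._<? x) u) (toNat (does (a Fin.<? x))) (Vec.count (a Fin.<?_) u) (inv u)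
    where
    lemma : ∀ a b c d → a + b + (c + d) ≡ b + c + (a + d)
    lemma = ℕ.solve-∀

  -- majFrom i of u followed by a letter that lies below exactly the letters x with t ≤ toℕ x.
  majTo : ℕ → ℕ → Vec (Fin n) m → ℕ
  majTo i t []          = 0
  majTo i t (x ∷ [])    = if t <ᵇ suc (toℕ x) then i else 0
  majTo i t (x ∷ y ∷ u) = (if does (y Fin.<? x) then i else 0) + majTo (suc i) t (y ∷ u)

  -- Seen from `u`, the next letter is `a`, which lies below exactly the letters from `suc (toℕ a)`
  -- on. The letter `a` itself has position `i + m`, a descent there if it reaches the threshold
  -- `t`.
  majTo-∷ʳ : ∀ i t (u : Vec (Fin n) m) (a : Fin n) →
    majTo i t (u ∷ʳ a) ≡ majTo i (suc (toℕ a)) u + (if t <ᵇ suc (toℕ a) then i + m else 0)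
  majTo-∷ʳ i t []      a rewrite ℕ.+-identityʳ i = refl
  majTo-∷ʳ i t (x ∷ []) a rewrite ℕ.+-comm i 1 = refl
  majTo-∷ʳ {m = suc (suc m)} i t (x ∷ y ∷ u) a rewrite majTo-∷ʳ (suc i) t (y ∷ u) a | ℕ.+-suc i (suc m) =
    sym (ℕ.+-assoc (if does (y Fin.<? x) then i else 0) _ _)

  <ᵇ-toℕ : (x : Fin n) → (n <ᵇ suc (toℕ x)) ≡ false
  <ᵇ-toℕ zero    = refl
  <ᵇ-toℕ (suc x) = <ᵇ-toℕ x

  -- No letter reaches the threshold `n`, so no descent is added at the end.
  majTo-max : ∀ i (w : Vec (Fin n) m) → majTo i n w ≡ majFrom Fin._<?_ i w
  majTo-max i []          = refl
  majTo-max i (x ∷ [])    rewrite <ᵇ-toℕ x = refl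
  majTo-max i (x ∷ y ∷ w) = cong (_ +_) (majTo-max (suc i) (y ∷ w))

open Words

-- Finite sums in a commutative semiring.

module WeightedSums {c ℓ} (R : CommutativeSemiring c ℓ) where
  open CommutativeSemiring R hiding (zero)
  open RawSemiringDefs rawSemiring using (product)
  open SemiringSum semiring using (sum; sum-cong-≋; sum-replicate-zero; *-distribˡ-sum)
  open MonoidSum *-commutativeMonoid using ()
    renaming (sum-cong-≋ to product-cong; ∑-distrib-+ to product-distrib-*)
  open SemiringExp semiring using (_^_; ^-congˡ; ^-congʳ; ^-homo-*; ^-assocʳ)
  open Exp R using (^-distrib-*)
  open RingSolver R using (solve; _:=_; _:+_; _:*_)
  open import Relation.Binary.Reasoning.Setoid setoid

  private variable
    a b p : Level
    A : Set a
    B : Set b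
    r n m : ℕ

  -- The same fold as in the statement, so that the two sums agree definitionally for polynomials.
  ∑ : List A → (A → Carrier) → Carrier
  ∑ xs f = List.foldr (λ x s → f x + s) 0# xs

  ∑-cong : (xs : List A) {f g : A → Carrier} → (∀ x → f x ≈ g x) → ∑ xs f ≈ ∑ xs g
  ∑-cong []       f≈g = refl
  ∑-cong (x ∷ xs) f≈g = +-cong (f≈g x) (∑-cong xs f≈g)

  ∑-zero : (xs : List A) → ∑ xs (λ _ → 0#) ≈ 0#
  ∑-zero []       = refl
  ∑-zero (x ∷ xs) = trans (+-identityˡ _) (∑-zero xs)

  ∑-+ : (xs : List A) (f g : A → Carrier) → ∑ xs (λ x → f x + g x) ≈ ∑ xs f + ∑ xs g
  ∑-+ []       f g = sym (+-identityˡ 0#)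
  ∑-+ (x ∷ xs) f g = trans (+-congˡ (∑-+ xs f g))
    (solve 4 (λ a b c d → (a :+ b) :+ (c :+ d) := (a :+ c) :+ (b :+ d)) refl (f x) (g x) (∑ xs f) (∑ xs g))

  ∑-*ˡ : (y : Carrier) (xs : List A) (f : A → Carrier) → ∑ xs (λ x → y * f x) ≈ y * ∑ xs f
  ∑-*ˡ y []       f = sym (zeroʳ y)
  ∑-*ˡ y (x ∷ xs) f = trans (+-congˡ (∑-*ˡ y xs f)) (sym (distribˡ y (f x) (∑ xs f)))

  ∑-*ʳ : (y : Carrier) (xs : List A) (f : A → Carrier) → ∑ xs (λ x → f x * y) ≈ ∑ xs f * y
  ∑-*ʳ y []       f = sym (zeroˡ y)
  ∑-*ʳ y (x ∷ xs) f = trans (+-congˡ (∑-*ʳ y xs f)) (sym (distribʳ y (f x) (∑ xs f)))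

  ∑-comm : (xs : List A) (ys : List B) (f : A → B → Carrier) →
    ∑ xs (λ x → ∑ ys (f x)) ≈ ∑ ys (λ y → ∑ xs (λ x → f x y))
  ∑-comm []       ys f = sym (∑-zero ys)
  ∑-comm (x ∷ xs) ys f = trans (+-congˡ (∑-comm xs ys f)) (sym (∑-+ ys (f x) _))

  ∑-++ : (xs ys : List A) (f : A → Carrier) → ∑ (xs ++ ys) f ≈ ∑ xs f + ∑ ys f
  ∑-++ []       ys f = sym (+-identityˡ _)
  ∑-++ (x ∷ xs) ys f = trans (+-congˡ (∑-++ xs ys f)) (sym (+-assoc _ _ _))

  ∑-map : (g : A → B) (xs : List A) (f : B → Carrier) → ∑ (List.map g xs) f ≡ ∑ xs (f ∘ g)
  ∑-map g []       f = ≡.refl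
  ∑-map g (x ∷ xs) f = ≡.cong (f (g x) +_) (∑-map g xs f)

  ∑-cartesianProductWith : ∀ {d} {D : Set d} (g : A → B → D) (xs : List A) (ys : List B) (f : D → Carrier) →
    ∑ (List.cartesianProductWith g xs ys) f ≈ ∑ xs (λ x → ∑ ys (λ y → f (g x y)))
  ∑-cartesianProductWith g []       ys f = refl
  ∑-cartesianProductWith g (x ∷ xs) ys f = begin
    ∑ (List.map (g x) ys ++ List.cartesianProductWith g xs ys) f              ≈⟨ ∑-++ (List.map (g x) ys) _ f ⟩
    ∑ (List.map (g x) ys) f + ∑ (List.cartesianProductWith g xs ys) f         ≈⟨ +-cong (reflexive (∑-map (g x) ys f)) (∑-cartesianProductWith g xs ys f) ⟩
    ∑ ys (λ y → f (g x y)) + ∑ xs (λ x → ∑ ys (λ y → f (g x y)))              ∎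

  ∑-tabulate : (g : Fin n → A) (f : A → Carrier) → ∑ (List.tabulate g) f ≡ sum (f ∘ g)
  ∑-tabulate {n = zero}  g f = ≡.refl
  ∑-tabulate {n = suc n} g f = ≡.cong (f (g zero) +_) (∑-tabulate (g ∘ suc) f)

  ∑-allFin : ∀ n (f : Fin n → Carrier) → ∑ (List.allFin n) f ≈ sum f
  ∑-allFin n f = reflexive (∑-tabulate {n = n} (λ i → i) f)

  𝟙 : Bool → Carrier
  𝟙 b = if b then 1# else 0#

  𝟙-∧ : ∀ b c → 𝟙 (b ∧ c) ≈ 𝟙 b * 𝟙 c
  𝟙-∧ true  c = sym (*-identityˡ _)
  𝟙-∧ false c = sym (zeroˡ _)

  𝟙-*-cong : ∀ b {x y} → (b ≡ true → x ≈ y) → 𝟙 b * x ≈ 𝟙 b * y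
  𝟙-*-cong true  x≈y = *-congˡ (x≈y ≡.refl)
  𝟙-*-cong false x≈y = trans (zeroˡ _) (sym (zeroˡ _))

  ∑-filter : {P : U.Pred A p} (P? : U.Decidable P) (xs : List A) (f : A → Carrier) →
    ∑ (List.filter P? xs) f ≈ ∑ xs (λ x → 𝟙 (does (P? x)) * f x)
  ∑-filter P? []       f = refl
  ∑-filter P? (x ∷ xs) f with does (P? x)
  ... | true  = +-cong (sym (*-identityˡ _)) (∑-filter P? xs f)
  ... | false = trans (∑-filter P? xs f) (sym (trans (+-congʳ (zeroˡ _)) (+-identityˡ _)))

  ∑-vectors-∷ : (as : List A) (m : ℕ) (f : Vec A (suc m) → Carrier) →
    ∑ (vectors as (suc m)) f ≈ ∑ as (λ a → ∑ (vectors as m) (λ v → f (a ∷ v)))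
  ∑-vectors-∷ as m f = ∑-cartesianProductWith _∷_ as (vectors as m) f

  -- `vectors` prepends entries, whereas the last color and the last letter are the ones to be
  -- summed separately. The lists differ in order, which the sum does not see.
  ∑-vectors-∷ʳ : (as : List A) (m : ℕ) (f : Vec A (suc m) → Carrier) →
    ∑ (vectors as (suc m)) f ≈ ∑ (vectors as m) (λ v → ∑ as (λ a → f (v ∷ʳ a)))
  ∑-vectors-∷ʳ as zero    f = begin
    ∑ (vectors as 1) f                       ≈⟨ ∑-vectors-∷ as 0 f ⟩
    ∑ as (λ a → f (a ∷ []) + 0#)             ≈⟨ ∑-cong as (λ a → +-identityʳ _) ⟩
    ∑ as (λ a → f (a ∷ []))                  ≈⟨ +-identityʳ _ ⟨
    ∑ as (λ a → f (a ∷ [])) + 0#             ∎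
  ∑-vectors-∷ʳ as (suc m) f = begin
    ∑ (vectors as (suc (suc m))) f                                             ≈⟨ ∑-vectors-∷ as (suc m) f ⟩
    ∑ as (λ b → ∑ (vectors as (suc m)) (λ v → f (b ∷ v)))                      ≈⟨ ∑-cong as (λ b → ∑-vectors-∷ʳ as m (λ v → f (b ∷ v))) ⟩
    ∑ as (λ b → ∑ (vectors as m) (λ v → ∑ as (λ a → f (b ∷ (v ∷ʳ a)))))          ≈⟨ ∑-vectors-∷ as m (λ v → ∑ as (λ a → f (v ∷ʳ a))) ⟨
    ∑ (vectors as (suc m)) (λ v → ∑ as (λ a → f (v ∷ʳ a)))                     ∎

  -- Separates letters from colors, so that the colors can be summed over a fixed underlying word.
  ∑-vectors-zip : (as : List A) (bs : List B) (m : ℕ) (f : Vec (A × B) m → Carrier) →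
    ∑ (vectors (List.cartesianProduct as bs) m) f
      ≈ ∑ (vectors as m) (λ v → ∑ (vectors bs m) (λ w → f (Vec.zip v w)))
  ∑-vectors-zip as bs zero    f = sym (+-identityʳ _)
  ∑-vectors-zip as bs (suc m) f = begin
    ∑ (vectors (List.cartesianProduct as bs) (suc m)) f
      ≈⟨ ∑-vectors-∷ (List.cartesianProduct as bs) m f ⟩
    ∑ (List.cartesianProduct as bs) (λ x → ∑ (vectors (List.cartesianProduct as bs) m) (λ u → f (x ∷ u)))
      ≈⟨ ∑-cartesianProductWith _,_ as bs _ ⟩
    ∑ as (λ a → ∑ bs (λ b → ∑ (vectors (List.cartesianProduct as bs) m) (λ u → f ((a , b) ∷ u))))
      ≈⟨ ∑-cong as (λ a → ∑-cong bs (λ b → ∑-vectors-zip as bs m (λ u → f ((a , b) ∷ u)))) ⟩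
    ∑ as (λ a → ∑ bs (λ b → ∑ (vectors as m) (λ v → ∑ (vectors bs m) (λ w → f ((a , b) ∷ Vec.zip v w)))))
      ≈⟨ ∑-cong as (λ a → ∑-comm bs (vectors as m) _) ⟩
    ∑ as (λ a → ∑ (vectors as m) (λ v → ∑ bs (λ b → ∑ (vectors bs m) (λ w → f ((a , b) ∷ Vec.zip v w)))))
      ≈⟨ ∑-cong as (λ a → ∑-cong (vectors as m) (λ v → ∑-vectors-∷ bs m (λ w → f (Vec.zip (a ∷ v) w)))) ⟨
    ∑ as (λ a → ∑ (vectors as m) (λ v → ∑ (vectors bs (suc m)) (λ w → f (Vec.zip (a ∷ v) w))))
      ≈⟨ ∑-vectors-∷ as m (λ v → ∑ (vectors bs (suc m)) (λ w → f (Vec.zip v w))) ⟨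
    ∑ (vectors as (suc m)) (λ v → ∑ (vectors bs (suc m)) (λ w → f (Vec.zip v w)))
      ∎

  sum-≟ : (i : Fin n) (f : Fin n → Carrier) → sum (λ j → 𝟙 (does (j Fin.≟ i)) * f j) ≈ f i
  sum-≟ {suc n} zero    f = begin
    1# * f zero + sum (λ j → 0# * f (suc j))   ≈⟨ +-cong (*-identityˡ _) (sum-cong-≋ {n} (λ j → zeroˡ _)) ⟩
    f zero + sum {n} (λ _ → 0#)                ≈⟨ +-congˡ (sum-replicate-zero n) ⟩
    f zero + 0#                                ≈⟨ +-identityʳ _ ⟩
    f zero                                     ∎
  sum-≟ (suc i) f = trans (+-congʳ (zeroˡ _)) (trans (+-identityˡ _) (sum-≟ i (f ∘ suc)))

  ∑-vectors-≟ : (w : Vec (Fin n) m) (f : Vec (Fin n) m → Carrier) →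
    ∑ (vectors (List.allFin n) m) (λ v → 𝟙 (does (≡-dec Fin._≟_ v w)) * f v) ≈ f w
  ∑-vectors-≟ []      f = trans (+-identityʳ _) (*-identityˡ _)
  ∑-vectors-≟ {n} {suc m} (a ∷ w) f = begin
    ∑ (vectors (List.allFin n) (suc m)) (λ v → 𝟙 (does (≡-dec Fin._≟_ v (a ∷ w))) * f v)
      ≈⟨ ∑-vectors-∷ (List.allFin n) m _ ⟩
    ∑ (List.allFin n) (λ b → ∑ (vectors (List.allFin n) m) (λ v → 𝟙 (does (b Fin.≟ a) ∧ does (≡-dec Fin._≟_ v w)) * f (b ∷ v)))
      ≈⟨ ∑-cong (List.allFin n) (λ b → trans (∑-cong (vectors (List.allFin n) m) (λ v →
           trans (*-congʳ (𝟙-∧ (does (b Fin.≟ a)) (does (≡-dec Fin._≟_ v w)))) (*-assoc _ _ _)))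
           (∑-*ˡ _ (vectors (List.allFin n) m) _)) ⟩
    ∑ (List.allFin n) (λ b → 𝟙 (does (b Fin.≟ a)) * ∑ (vectors (List.allFin n) m) (λ v → 𝟙 (does (≡-dec Fin._≟_ v w)) * f (b ∷ v)))
      ≈⟨ ∑-cong (List.allFin n) (λ b → *-congˡ (∑-vectors-≟ w (λ v → f (b ∷ v)))) ⟩
    ∑ (List.allFin n) (λ b → 𝟙 (does (b Fin.≟ a)) * f (b ∷ w))
      ≈⟨ ∑-allFin n _ ⟩
    sum (λ b → 𝟙 (does (b Fin.≟ a)) * f (b ∷ w))
      ≈⟨ sum-≟ a (λ b → f (b ∷ w)) ⟩
    f (a ∷ w)
      ∎

  -- Sums over initial segments; `S m (y ^_)` is the q-integer of `m` at `y`.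

  S : ℕ → (ℕ → Carrier) → Carrier
  S n f = sum {n} (f ∘ toℕ)

  S-cong< : ∀ n {f g : ℕ → Carrier} → (∀ k → k < n → f k ≈ g k) → S n f ≈ S n g
  S-cong< n f≈g = sum-cong-≋ {n} (λ i → f≈g (toℕ i) (Fin.toℕ<n i))

  S-cong : ∀ n {f g : ℕ → Carrier} → (∀ k → f k ≈ g k) → S n f ≈ S n g
  S-cong n f≈g = sum-cong-≋ {n} (f≈g ∘ toℕ)

  S-*ˡ : ∀ n y (f : ℕ → Carrier) → S n (λ k → y * f k) ≈ y * S n f
  S-*ˡ n y f = sym (*-distribˡ-sum {n} y (f ∘ toℕ))

  S-split : ∀ m n (f : ℕ → Carrier) → S (m ℕ.+ n) f ≈ S m f + S n (f ∘ (m ℕ.+_))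
  S-split zero    n f = sym (+-identityˡ _)
  S-split (suc m) n f = trans (+-congˡ (S-split m n (f ∘ suc))) (sym (+-assoc _ _ _))

  S-last : ∀ m (f : ℕ → Carrier) → S (suc m) f ≈ S m f + f m
  S-last zero    f = +-comm _ _
  S-last (suc m) f = trans (+-congˡ (S-last m (f ∘ suc))) (sym (+-assoc _ _ _))

  product-last : ∀ m (f : ℕ → Carrier) → product {suc m} (f ∘ toℕ) ≈ product {m} (f ∘ toℕ) * f m
  product-last zero    f = *-comm _ _
  product-last (suc m) f = trans (*-congˡ (product-last m (f ∘ suc))) (sym (*-assoc _ _ _))

  -- Passing from s to suc s replaces the term at s by the term at s + r, which is equal to it.
  sum-divisible : ∀ r .{{_ : NonZero r}} s → S r (λ a → 𝟙 (does (r ∣? (s ℕ.+ a)))) ≈ 1#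
  sum-divisible r@(suc m) zero = begin
    S r (λ a → 𝟙 (does (r ∣? a)))                  ≈⟨ +-cong (reflexive (≡.cong 𝟙 (dec-true (r ∣? 0) (r ℕ.∣0)))) (S-cong< m λ a a<m →
                                                      reflexive (≡.cong 𝟙 (dec-false (r ∣? suc a) (ℕ.>⇒∤ (s<s a<m))))) ⟩
    1# + S m (λ _ → 0#)                            ≈⟨ +-congˡ (sum-replicate-zero m) ⟩
    1# + 0#                                        ≈⟨ +-identityʳ 1# ⟩
    1#                                             ∎
  sum-divisible r@(suc m) (suc s) = begin
    S r (λ a → h (suc (s ℕ.+ a)))                       ≈⟨ S-last m (λ a → h (suc (s ℕ.+ a))) ⟩
    S m (λ a → h (suc (s ℕ.+ a))) + h (suc (s ℕ.+ m))   ≈⟨ +-comm _ _ ⟩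
    h (suc (s ℕ.+ m)) + S m (λ a → h (suc (s ℕ.+ a)))   ≈⟨ +-cong (reflexive periodic) (S-cong m λ a → reflexive (≡.cong h (≡.sym (ℕ.+-suc s a)))) ⟩
    h (s ℕ.+ 0) + S m (λ a → h (s ℕ.+ suc a))           ≈⟨ sum-divisible r s ⟩
    1#                                                  ∎
    where
    h : ℕ → Carrier
    h k = 𝟙 (does (r ∣? k))
    periodic : h (suc (s ℕ.+ m)) ≡ h (s ℕ.+ 0)
    periodic rewrite ℕ.+-identityʳ s | ≡.sym (ℕ.+-suc s m) = ≡.cong 𝟙
      (does-⇔ (mk⇔ (λ r∣s+r → ℕ.∣m+n∣m⇒∣n (≡.subst (r ℕ.∣_) (ℕ.+-comm s r) r∣s+r) ℕ.∣-refl)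
                   (λ r∣s → ℕ.∣m∣n⇒∣m+n r∣s ℕ.∣-refl))
        (r ∣? (s ℕ.+ r)) (r ∣? s))

  -- The colors below, at and above `c` give three blocks of gaps, which fill 0, ..., r - 1 without
  -- a descent of the letters and 1, ..., r with one. In particular the sum does not depend on `c`.
  colorGap-sum : ∀ X b {r c} → c < r → S r (λ z → X ^ colorGap r b z c) ≈ X ^ toNat b * S r (X ^_)
  colorGap-sum X b {r} {c} c<r with ℕ.m≤n⇒∃[o]m+o≡n c<r
  -- The range of colors is cut at `c`: r = c + suc d, with `d` colors above `c`.
  ... | d , ≡.refl = ≡.subst (λ r → S r (λ z → X ^ colorGap r b z c) ≈ X ^ toNat b * S r (X ^_)) (ℕ.+-suc c d) (begin
    S (c ℕ.+ suc d) F
      ≈⟨ S-split c (suc d) F ⟩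
    S c F + (F (c ℕ.+ 0) + S d (λ k → F (c ℕ.+ suc k)))
      ≈⟨ +-cong (S-cong< c λ z z<c → ^-congʳ X (colorGap-< b z<c))
           (+-cong (^-congʳ X (≡.trans (≡.cong (λ z → colorGap (c ℕ.+ suc d) b z c) (ℕ.+-identityʳ c)) (colorGap-refl (c ℕ.+ suc d) b c)))
                   (S-cong d λ k → ^-congʳ X (colorGap-> (c ℕ.+ suc d) b c k))) ⟩
    S c (λ z → X ^ suc (d ℕ.+ z)) + (X ^ (if b then c ℕ.+ suc d else 0) + S d (λ k → X ^ suc k))
      ≈⟨ cyclic b ⟩
    X ^ toNat b * S (c ℕ.+ suc d) (X ^_)
      ∎)
    where
    F : ℕ → Carrier
    F z = X ^ colorGap (c ℕ.+ suc d) b z c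
    cyclic : ∀ b → S c (λ z → X ^ suc (d ℕ.+ z)) + (X ^ (if b then c ℕ.+ suc d else 0) + S d (λ k → X ^ suc k))
                     ≈ X ^ toNat b * S (c ℕ.+ suc d) (X ^_)
    cyclic false = begin
      S c (λ z → X ^ suc (d ℕ.+ z)) + S (suc d) (X ^_)        ≈⟨ +-comm _ _ ⟩
      S (suc d) (X ^_) + S c (λ z → X ^ suc (d ℕ.+ z))        ≈⟨ S-split (suc d) c (X ^_) ⟨
      S (suc d ℕ.+ c) (X ^_)                                  ≡⟨ ≡.cong (λ r → S r (X ^_)) (ℕ.+-comm (suc d) c) ⟩
      S (c ℕ.+ suc d) (X ^_)                                  ≈⟨ *-identityˡ _ ⟨
      1# * S (c ℕ.+ suc d) (X ^_)                             ∎
    -- Here color `c` itself yields the largest exponent, `c + suc d`. Placed last, it completes the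
    -- exponents 1, ..., c + suc d, and one factor `X` comes out.
    cyclic true = begin
      S c (λ z → X ^ suc (d ℕ.+ z)) + (X ^ (c ℕ.+ suc d) + S d (λ k → X ^ suc k))
        ≈⟨ solve 3 (λ a b c → a :+ (b :+ c) := (c :+ a) :+ b) refl
             (S c (λ z → X ^ suc (d ℕ.+ z))) (X ^ (c ℕ.+ suc d)) (S d (λ k → X ^ suc k)) ⟩
      (S d (λ k → X ^ suc k) + S c (λ z → X ^ suc (d ℕ.+ z))) + X ^ (c ℕ.+ suc d)
        ≈⟨ +-cong (sym (S-split d c (λ k → X ^ suc k))) (^-congʳ X (ℕ.+-comm c (suc d))) ⟩
      S (d ℕ.+ c) (λ k → X ^ suc k) + X ^ suc (d ℕ.+ c)
        ≈⟨ S-last (d ℕ.+ c) (λ k → X ^ suc k) ⟨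
      S (suc (d ℕ.+ c)) (λ k → X * X ^ k)
        ≈⟨ S-*ˡ (suc (d ℕ.+ c)) X (X ^_) ⟩
      X * S (suc (d ℕ.+ c)) (X ^_)
        ≈⟨ *-cong (sym (*-identityʳ X)) (reflexive (≡.cong (λ r → S r (X ^_)) (ℕ.+-comm (suc d) c))) ⟩
      X ^ 1 * S (c ℕ.+ suc d) (X ^_)
        ∎

  -- Summation over the colors and identity (i).

  module _ (x : Carrier) where

    -- The first color enters only through its gap. Summed innermost, it gives by `colorGap-sum` a
    -- factor independent of the later colors, and induction handles the rest.
    fmajFrom-sum : ∀ r .{{_ : NonZero r}} i (w : Vec (Fin n) (suc m)) →
      ∑ (vectors (List.allFin r) m) (λ z → x ^ fmajFrom i (Vec.zip w (z ∷ʳ colorZero r)))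
        ≈ x ^ majFrom Fin._<?_ (suc i) w * product {m} (λ j → S r ((x ^ suc (i ℕ.+ toℕ j)) ^_))
    fmajFrom-sum r i (a ∷ []) = begin
      x ^ fmajFrom i ((a , colorZero r) ∷ []) + 0#   ≈⟨ +-identityʳ _ ⟩
      x ^ fmajFrom i ((a , colorZero r) ∷ [])        ≈⟨ ^-congʳ x weight≡0 ⟩
      1#                                             ≈⟨ *-identityʳ _ ⟨
      1# * 1#                                        ∎
      where
      weight≡0 : fmajFrom i ((a , colorZero r) ∷ []) ≡ 0
      weight≡0 rewrite Fin.toℕ-fromℕ< (ℕ.>-nonZero⁻¹ r) | ℕ.*-zeroʳ r = ℕ.*-zeroʳ i
    fmajFrom-sum {m = suc m} r i (a ∷ b ∷ w) = begin
      ∑ (vectors cs (suc m)) (λ z → x ^ fmajFrom i (Vec.zip (a ∷ b ∷ w) (z ∷ʳ c₀)))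
        ≈⟨ ∑-vectors-∷ cs m _ ⟩
      ∑ cs (λ c → ∑ (vectors cs m) (λ z → x ^ fmajFrom i (Vec.zip (a ∷ b ∷ w) (c ∷ (z ∷ʳ c₀)))))
        ≈⟨ ∑-comm cs (vectors cs m) _ ⟩
      ∑ (vectors cs m) (λ z → ∑ cs (λ c → x ^ fmajFrom i (Vec.zip (a ∷ b ∷ w) (c ∷ (z ∷ʳ c₀)))))
        ≈⟨ ∑-cong (vectors cs m) (λ z → firstColor (z ∷ʳ c₀)) ⟩
      ∑ (vectors cs m) (λ z → (X ^ toNat d * S r (X ^_)) * x ^ fmajFrom (suc i) (Vec.zip (b ∷ w) (z ∷ʳ c₀)))
        ≈⟨ ∑-*ˡ _ (vectors cs m) _ ⟩
      (X ^ toNat d * S r (X ^_)) * ∑ (vectors cs m) (λ z → x ^ fmajFrom (suc i) (Vec.zip (b ∷ w) (z ∷ʳ c₀)))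
        ≈⟨ *-congˡ (fmajFrom-sum r (suc i) (b ∷ w)) ⟩
      (X ^ toNat d * S r (X ^_)) * (x ^ majFrom Fin._<?_ (suc (suc i)) (b ∷ w) * P (suc i))
        ≈⟨ solve 4 (λ a b c d → (a :* b) :* (c :* d) := (a :* c) :* (b :* d)) refl
             (X ^ toNat d) (S r (X ^_)) (x ^ majFrom Fin._<?_ (suc (suc i)) (b ∷ w)) (P (suc i)) ⟩
      (X ^ toNat d * x ^ majFrom Fin._<?_ (suc (suc i)) (b ∷ w)) * (S r (X ^_) * P (suc i))
        ≈⟨ *-cong (*-congʳ (descent d)) (*-cong (S-cong r λ k → ^-congˡ k (^-congʳ x (≡.cong suc (≡.sym (ℕ.+-identityʳ i)))))
             (product-cong {m} λ j → S-cong r λ k → ^-congˡ k (^-congʳ x (≡.cong suc (≡.sym (ℕ.+-suc i (toℕ j))))))) ⟩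
      (x ^ (if d then suc i else 0) * x ^ majFrom Fin._<?_ (suc (suc i)) (b ∷ w))
        * product {suc m} (λ j → S r ((x ^ suc (i ℕ.+ toℕ j)) ^_))
        ≈⟨ *-congʳ (^-homo-* x (if d then suc i else 0) _) ⟨
      x ^ majFrom Fin._<?_ (suc i) (a ∷ b ∷ w) * product {suc m} (λ j → S r ((x ^ suc (i ℕ.+ toℕ j)) ^_))
        ∎
      where
      cs : List (Fin r)
      cs = List.allFin r
      c₀ : Fin r
      c₀ = colorZero r
      X : Carrier
      X = x ^ suc i
      d : Bool
      d = does (b Fin.<? a)
      P : ℕ → Carrier
      P i = product {m} (λ j → S r ((x ^ suc (i ℕ.+ toℕ j)) ^_))
      descent : ∀ d → X ^ toNat d ≈ x ^ (if d then suc i else 0)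
      descent true  = *-identityʳ X
      descent false = refl
      firstColor : (v : Vec (Fin r) (suc m)) →
        ∑ cs (λ c → x ^ fmajFrom i (Vec.zip (a ∷ b ∷ w) (c ∷ v)))
          ≈ (X ^ toNat d * S r (X ^_)) * x ^ fmajFrom (suc i) (Vec.zip (b ∷ w) v)
      firstColor v = begin
        ∑ cs (λ c → x ^ fmajFrom i (Vec.zip (a ∷ b ∷ w) (c ∷ v)))
          ≈⟨ ∑-cong cs (λ c → trans (^-congʳ x (fmajFrom-∷ i a b w c v)) (trans (^-homo-* x (suc i ℕ.* gap (toℕ c)) _)
               (*-congʳ (sym (^-assocʳ x (suc i) (gap (toℕ c))))))) ⟩
        ∑ cs (λ c → X ^ gap (toℕ c) * x ^ fmajFrom (suc i) (Vec.zip (b ∷ w) v))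
          ≈⟨ ∑-*ʳ _ cs _ ⟩
        ∑ cs (λ c → X ^ gap (toℕ c)) * x ^ fmajFrom (suc i) (Vec.zip (b ∷ w) v)
          ≈⟨ *-congʳ (trans (∑-allFin r _) (colorGap-sum X d (Fin.toℕ<n (Vec.head v)))) ⟩
        (X ^ toNat d * S r (X ^_)) * x ^ fmajFrom (suc i) (Vec.zip (b ∷ w) v)
          ∎
        where
        gap : ℕ → ℕ
        gap z = colorGap r d z (toℕ (Vec.head v))

    -- For any choice of the other colors exactly one last color makes the color sum divisible by
    -- `r`, and `Dmaj` treats that color as 0.
    Dmaj-sum : ∀ r .{{_ : NonZero r}} (w : Vec (Fin n) (suc m)) →
      ∑ (vectors (List.allFin r) (suc m)) (λ z → 𝟙 (does (r ∣? colors z)) * x ^ Dmaj (Vec.zip w z))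
        ≈ x ^ maj w * product {m} (λ j → S r ((x ^ suc (toℕ j)) ^_))
    Dmaj-sum {m = m} r w = begin
      ∑ (vectors cs (suc m)) (λ z → 𝟙 (does (r ∣? colors z)) * x ^ Dmaj (Vec.zip w z))
        ≈⟨ ∑-vectors-∷ʳ cs m _ ⟩
      ∑ (vectors cs m) (λ z → ∑ cs (λ c → 𝟙 (does (r ∣? colors (z ∷ʳ c))) * x ^ Dmaj (Vec.zip w (z ∷ʳ c))))
        ≈⟨ ∑-cong (vectors cs m) lastColor ⟩
      ∑ (vectors cs m) (λ z → x ^ fmajFrom 0 (Vec.zip w (z ∷ʳ colorZero r)))
        ≈⟨ fmajFrom-sum r 0 w ⟩
      x ^ maj w * product {m} (λ j → S r ((x ^ suc (toℕ j)) ^_))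
        ∎
      where
      cs : List (Fin r)
      cs = List.allFin r
      lastColor : ∀ z → ∑ cs (λ c → 𝟙 (does (r ∣? colors (z ∷ʳ c))) * x ^ Dmaj (Vec.zip w (z ∷ʳ c)))
                          ≈ x ^ fmajFrom 0 (Vec.zip w (z ∷ʳ colorZero r))
      lastColor z = begin
        ∑ cs (λ c → 𝟙 (does (r ∣? colors (z ∷ʳ c))) * x ^ Dmaj (Vec.zip w (z ∷ʳ c)))
          ≈⟨ ∑-cong cs (λ c → *-cong
               (reflexive (≡.cong (λ s → 𝟙 (does (r ∣? s))) (colors-∷ʳ z c)))
               (^-congʳ x (≡.trans (≡.cong fmaj (uncolorLast-zip w z c)) (≡.sym (ℕ.+-identityʳ _))))) ⟩
        ∑ cs (λ c → 𝟙 (does (r ∣? (colors z ℕ.+ toℕ c))) * x ^ fmajFrom 0 (Vec.zip w (z ∷ʳ colorZero r)))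
          ≈⟨ ∑-*ʳ _ cs _ ⟩
        ∑ cs (λ c → 𝟙 (does (r ∣? (colors z ℕ.+ toℕ c)))) * x ^ fmajFrom 0 (Vec.zip w (z ∷ʳ colorZero r))
          ≈⟨ *-congʳ (trans (∑-allFin r _) (sum-divisible r (colors z))) ⟩
        1# * x ^ fmajFrom 0 (Vec.zip w (z ∷ʳ colorZero r))
          ≈⟨ *-identityˡ _ ⟩
        x ^ fmajFrom 0 (Vec.zip w (z ∷ʳ colorZero r))
          ∎

    -- The color factor is the same for every underlying permutation. The weight `h` is arbitrary so
    -- that it can carry a sign or an indicator, as both identities require.
    G*-sum : ∀ r m .{{_ : NonZero r}} (h : Vec (Fin (suc m)) (suc m) → Carrier) →
      ∑ (G* r (suc m)) (λ π → h ∣ π ∣ * x ^ Dmaj π)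
        ≈ ∑ (vectors (List.allFin (suc m)) (suc m)) (λ w → 𝟙 (does (isPermutation? w)) * (h w * x ^ maj w))
            * product {m} (λ j → S r ((x ^ suc (toℕ j)) ^_))
    G*-sum r m h = begin
      ∑ (G* r N) (λ π → h ∣ π ∣ * x ^ Dmaj π)
        ≈⟨ ∑-filter (λ π → r ∣? col π) (G r N) _ ⟩
      ∑ (G r N) (λ π → 𝟙 (does (r ∣? col π)) * (h ∣ π ∣ * x ^ Dmaj π))
        ≈⟨ ∑-filter (λ π → isPermutation? ∣ π ∣) (vectors (List.cartesianProduct (List.allFin N) cs) N) _ ⟩
      ∑ (vectors (List.cartesianProduct (List.allFin N) cs) N)
        (λ π → 𝟙 (does (isPermutation? ∣ π ∣)) * (𝟙 (does (r ∣? col π)) * (h ∣ π ∣ * x ^ Dmaj π)))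
        ≈⟨ ∑-vectors-zip (List.allFin N) cs N _ ⟩
      ∑ ws (λ w → ∑ (vectors cs N) (λ z → 𝟙 (does (isPermutation? ∣ Vec.zip w z ∣))
        * (𝟙 (does (r ∣? col (Vec.zip w z))) * (h ∣ Vec.zip w z ∣ * x ^ Dmaj (Vec.zip w z)))))
        ≈⟨ ∑-cong ws (λ w → ∑-cong (vectors cs N) (λ z → uncolored w z)) ⟩
      ∑ ws (λ w → ∑ (vectors cs N) (λ z → (𝟙 (does (isPermutation? w)) * h w)
        * (𝟙 (does (r ∣? colors z)) * x ^ Dmaj (Vec.zip w z))))
        ≈⟨ ∑-cong ws (λ w → trans (∑-*ˡ _ (vectors cs N) _) (*-congˡ (Dmaj-sum r w))) ⟩
      ∑ ws (λ w → (𝟙 (does (isPermutation? w)) * h w) * (x ^ maj w * P))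
        ≈⟨ ∑-cong ws (λ w → solve 4 (λ a b c d → (a :* b) :* (c :* d) := (a :* (b :* c)) :* d) refl
             (𝟙 (does (isPermutation? w))) (h w) (x ^ maj w) P) ⟩
      ∑ ws (λ w → (𝟙 (does (isPermutation? w)) * (h w * x ^ maj w)) * P)
        ≈⟨ ∑-*ʳ P ws _ ⟩
      ∑ ws (λ w → 𝟙 (does (isPermutation? w)) * (h w * x ^ maj w)) * P
        ∎
      where
      N : ℕ
      N = suc m
      cs : List (Fin r)
      cs = List.allFin r
      ws : List (Vec (Fin N) N)
      ws = vectors (List.allFin N) N
      P : Carrier
      P = product {m} (λ j → S r ((x ^ suc (toℕ j)) ^_))
      uncolored : ∀ w z →
        𝟙 (does (isPermutation? ∣ Vec.zip w z ∣)) * (𝟙 (does (r ∣? col (Vec.zip w z))) * (h ∣ Vec.zip w z ∣ * x ^ Dmaj (Vec.zip w z)))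
          ≈ (𝟙 (does (isPermutation? w)) * h w) * (𝟙 (does (r ∣? colors z)) * x ^ Dmaj (Vec.zip w z))
      uncolored w z rewrite ∣zip∣ w z | col-zip w z =
        solve 4 (λ a b c d → a :* (b :* (c :* d)) := (a :* c) :* (b :* d)) refl
          (𝟙 (does (isPermutation? w))) (𝟙 (does (r ∣? colors z))) (h w) (x ^ Dmaj (Vec.zip w z))

    -- The condition on the underlying permutation is absorbed into the weight of `G*-sum`, which
    -- leaves a single summand.
    G*⟨⟩-sum : ∀ r m .{{_ : NonZero r}} (h : Vec (Fin (suc m)) (suc m) → Carrier) w → IsPermutation w →
      ∑ (G*⟨ w ⟩ r) (λ π → h ∣ π ∣ * x ^ Dmaj π)
        ≈ (h w * x ^ maj w) * product {m} (λ j → S r ((x ^ suc (toℕ j)) ^_))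
    G*⟨⟩-sum r m h w perm = begin
      ∑ (G*⟨ w ⟩ r) (λ π → h ∣ π ∣ * x ^ Dmaj π)
        ≈⟨ ∑-filter (λ π → ≡-dec Fin._≟_ ∣ π ∣ w) (G* r N) _ ⟩
      ∑ (G* r N) (λ π → 𝟙 (is-w ∣ π ∣) * (h ∣ π ∣ * x ^ Dmaj π))
        ≈⟨ ∑-cong (G* r N) (λ π → *-assoc _ _ _) ⟨
      ∑ (G* r N) (λ π → (𝟙 (is-w ∣ π ∣) * h ∣ π ∣) * x ^ Dmaj π)
        ≈⟨ G*-sum r m (λ v → 𝟙 (is-w v) * h v) ⟩
      ∑ ws (λ v → 𝟙 (does (isPermutation? v)) * ((𝟙 (is-w v) * h v) * x ^ maj v)) * P
        ≈⟨ *-congʳ (∑-cong ws (λ v → solve 4 (λ a b c d → a :* ((b :* c) :* d) := b :* (a :* (c :* d))) refl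
             (𝟙 (does (isPermutation? v))) (𝟙 (is-w v)) (h v) (x ^ maj v))) ⟩
      ∑ ws (λ v → 𝟙 (is-w v) * (𝟙 (does (isPermutation? v)) * (h v * x ^ maj v))) * P
        ≈⟨ *-congʳ (∑-vectors-≟ w _) ⟩
      (𝟙 (does (isPermutation? w)) * (h w * x ^ maj w)) * P
        ≈⟨ *-congʳ (trans (*-congʳ (reflexive (≡.cong 𝟙 (dec-true (isPermutation? w) perm)))) (*-identityˡ _)) ⟩
      (h w * x ^ maj w) * P
        ∎
      where
      N : ℕ
      N = suc m
      ws : List (Vec (Fin N) N)
      ws = vectors (List.allFin N) N
      is-w : Vec (Fin N) N → Bool
      is-w v = does (≡-dec Fin._≟_ v w)
      P : Carrier
      P = product {m} (λ j → S r ((x ^ suc (toℕ j)) ^_))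

  -- The exponents below `r * a` fall into `r` blocks of length `a`.
  S-* : ∀ y a r → S (r ℕ.* a) (y ^_) ≈ S a (y ^_) * S r ((y ^ a) ^_)
  S-* y a zero    = sym (zeroʳ _)
  S-* y a (suc r) = begin
    S (a ℕ.+ r ℕ.* a) (y ^_)                                        ≈⟨ S-split a (r ℕ.* a) (y ^_) ⟩
    S a (y ^_) + S (r ℕ.* a) (λ k → y ^ (a ℕ.+ k))                  ≈⟨ +-congˡ (trans (S-cong (r ℕ.* a) (^-homo-* y a)) (S-*ˡ (r ℕ.* a) (y ^ a) (y ^_))) ⟩
    S a (y ^_) + y ^ a * S (r ℕ.* a) (y ^_)                         ≈⟨ +-cong (sym (*-identityʳ _)) (*-congˡ (S-* y a r)) ⟩
    S a (y ^_) * 1# + y ^ a * (S a (y ^_) * S r ((y ^ a) ^_))       ≈⟨ +-congˡ (solve 3 (λ z s t → z :* (s :* t) := s :* (z :* t)) refl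
                                                                         (y ^ a) (S a (y ^_)) (S r ((y ^ a) ^_))) ⟩
    S a (y ^_) * 1# + S a (y ^_) * (y ^ a * S r ((y ^ a) ^_))       ≈⟨ distribˡ _ _ _ ⟨
    S a (y ^_) * (1# + y ^ a * S r ((y ^ a) ^_))                    ≈⟨ *-congˡ (+-congˡ (S-*ˡ r (y ^ a) ((y ^ a) ^_))) ⟨
    S a (y ^_) * S (suc r) ((y ^ a) ^_)                             ∎

  -- In decreasing order, the letters of U that are at least t get the exponents K, K + 1, …, and the
  -- others continue the count of larger letters; for K = |U| this is a cyclic shift of 0, …, |U| − 1.
  letter-sum : ∀ (g : ℕ → Carrier) K t (U : Fin n → Bool) →
    sum (λ a → 𝟙 (U a) * g ((if t <ᵇ suc (toℕ a) then K else 0) ℕ.+ cardinality (λ x → U x ∧ (toℕ a <ᵇ toℕ x))))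
      ≈ S (cardinality (λ x → U x ∧ (t <ᵇ suc (toℕ x)))) (λ l → g (K ℕ.+ l))
        + S (cardinality (λ x → U x ∧ not (t <ᵇ suc (toℕ x))))
            (λ l → g (cardinality (λ x → U x ∧ (t <ᵇ suc (toℕ x))) ℕ.+ l))
  letter-sum {zero}  g K t       U = sym (+-identityˡ 0#)
  letter-sum {suc n} g K zero    U with U zero | letter-sum g K zero (U ∘ suc)
  ... | false | ih = trans (+-congʳ (zeroˡ _)) (trans (+-identityˡ _) ih)
  -- At threshold 0 every letter belongs to the first group. The smallest one has the `j` others
  -- above it and takes the last exponent, `K + j`.
  ... | true  | ih
    rewrite ≡.trans (cardinality-cong (λ x → Bool.∧-zeroʳ (U (suc x)))) (cardinality-empty n) = begin
    1# * g (K ℕ.+ j) + _                                 ≈⟨ +-cong (*-identityˡ _) (trans ih (+-identityʳ _)) ⟩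
    g (K ℕ.+ j) + S j (λ l → g (K ℕ.+ l))                ≈⟨ +-comm _ _ ⟩
    S j (λ l → g (K ℕ.+ l)) + g (K ℕ.+ j)                ≈⟨ S-last j (λ l → g (K ℕ.+ l)) ⟨
    S (suc j) (λ l → g (K ℕ.+ l))                        ≈⟨ +-identityʳ _ ⟨
    S (suc j) (λ l → g (K ℕ.+ l)) + 0#                   ∎
    where
    j : ℕ
    j = cardinality (λ x → U (suc x) ∧ true)
  letter-sum {suc n} g K (suc t) U with U zero | letter-sum g K t (U ∘ suc)
  ... | false | ih = trans (+-congʳ (zeroˡ _)) (trans (+-identityˡ _) ih)
  -- The smallest letter is below the threshold and has all `j + d` others above it, so it takes the
  -- last exponent of the second range.
  ... | true  | ih
    rewrite ≡.trans (cardinality-cong (λ x → Bool.∧-identityʳ (U (suc x))))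
                    (cardinality-split (U ∘ suc) (λ x → t <ᵇ suc (toℕ x))) = begin
    1# * g (j ℕ.+ d) + _                                                      ≈⟨ +-cong (*-identityˡ _) ih ⟩
    g (j ℕ.+ d) + (S j (λ l → g (K ℕ.+ l)) + S d (λ l → g (j ℕ.+ l)))         ≈⟨ solve 3 (λ a b c → a :+ (b :+ c) := b :+ (c :+ a)) refl
                                                                                   (g (j ℕ.+ d)) (S j (λ l → g (K ℕ.+ l))) (S d (λ l → g (j ℕ.+ l))) ⟩
    S j (λ l → g (K ℕ.+ l)) + (S d (λ l → g (j ℕ.+ l)) + g (j ℕ.+ d))         ≈⟨ +-congˡ (S-last d (λ l → g (j ℕ.+ l))) ⟨
    S j (λ l → g (K ℕ.+ l)) + S (suc d) (λ l → g (j ℕ.+ l))                   ∎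
    where
    j d : ℕ
    j = cardinality (λ x → U (suc x) ∧ (t <ᵇ suc (toℕ x)))
    d = cardinality (λ x → U (suc x) ∧ not (t <ᵇ suc (toℕ x)))

  1^ : ∀ k → 1# ^ k ≈ 1#
  1^ zero    = refl
  1^ (suc k) = trans (*-identityˡ _) (1^ k)

  -- The Gessel-Simion formula and identity (ii).

  module _ (e x : Carrier) (e*e≈1 : e * e ≈ 1#) where

    cancel-e : ∀ y → e * (e * y) ≈ y
    cancel-e y = trans (sym (*-assoc e e y)) (trans (*-congʳ e*e≈1) (*-identityˡ y))

    -- The total exponent m (m + 1) is even.
    e^-even : ∀ m → (e ^ m) ^ suc m ≈ 1#
    e^-even zero    = 1^ 1
    e^-even (suc m) = begin
      (e ^ suc m) ^ suc (suc m)               ≈⟨ *-congˡ (^-distrib-* e (e ^ m) (suc m)) ⟩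
      e ^ suc m * (e ^ suc m * (e ^ m) ^ suc m) ≈⟨ *-congˡ (trans (*-congˡ (e^-even m)) (*-identityʳ _)) ⟩
      e ^ suc m * e ^ suc m                   ≈⟨ ^-distrib-* e e (suc m) ⟨
      (e * e) ^ suc m                         ≈⟨ ^-congˡ (suc m) e*e≈1 ⟩
      1# ^ suc m                              ≈⟨ 1^ (suc m) ⟩
      1#                                      ∎

    -- Signs vanish at exactly the power needed twice: for a descent at position m + 1 in
    -- `arrangement-sum`, and for joining q-integers in `factor`.
    [e^m*x]^[1+m] : ∀ m → (e ^ m * x) ^ suc m ≈ x ^ suc m
    [e^m*x]^[1+m] m = trans (^-distrib-* (e ^ m) x (suc m)) (trans (*-congʳ (e^-even m)) (*-identityˡ _))

    -- As e * e ≈ 1#, e ^ suc k stands for e ^ (k − 1) without truncation at k = 0.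
    arrangement-sum : ∀ k (U : Fin n → Bool) t → cardinality U ≡ k →
      ∑ (vectors (List.allFin n) k) (λ u → 𝟙 (distinctIn U u) * (e ^ inv u * x ^ majTo 1 t u))
        ≈ (e ^ suc k * x) ^ cardinality (λ a → U a ∧ (t <ᵇ suc (toℕ a)))
          * product {k} (λ i → S (suc (toℕ i)) ((e ^ toℕ i * x) ^_))
    arrangement-sum zero U t ∣U∣≡k
      rewrite cardinality-∧-≡0 U (λ a → t <ᵇ suc (toℕ a)) ∣U∣≡k =
      trans (+-identityʳ _) (*-identityˡ _)
    arrangement-sum {n} (suc m) U t ∣U∣≡k = begin
      ∑ (vectors as (suc m)) (λ u → 𝟙 (distinctIn U u) * (e ^ inv u * x ^ majTo 1 t u))
        ≈⟨ ∑-vectors-∷ʳ as m _ ⟩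
      ∑ (vectors as m) (λ u → ∑ as (λ a → 𝟙 (distinctIn U (u ∷ʳ a)) * (e ^ inv (u ∷ʳ a) * x ^ majTo 1 t (u ∷ʳ a))))
        ≈⟨ ∑-comm (vectors as m) as _ ⟩
      ∑ as (λ a → ∑ (vectors as m) (λ u → 𝟙 (distinctIn U (u ∷ʳ a)) * (e ^ inv (u ∷ʳ a) * x ^ majTo 1 t (u ∷ʳ a))))
        ≈⟨ ∑-cong as lastLetter ⟩
      ∑ as (λ a → (𝟙 (U a) * y ^ (K a ℕ.+ above a)) * P)
        ≈⟨ ∑-*ʳ P as _ ⟩
      ∑ as (λ a → 𝟙 (U a) * y ^ (K a ℕ.+ above a)) * P
        -- As K = `suc m` is the size of `U`, which is j + d, the two ranges together are the
        -- `suc m` consecutive exponents starting at `j`.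
        ≈⟨ *-congʳ (trans (∑-allFin n _) (letter-sum (y ^_) (suc m) t U)) ⟩
      (S j (λ l → y ^ (suc m ℕ.+ l)) + S d (λ l → y ^ (j ℕ.+ l))) * P
        ≈⟨ *-congʳ (+-congʳ (S-cong j λ l → ^-congʳ y (≡.trans (≡.cong (ℕ._+ l) 1+m≡j+d) (ℕ.+-assoc j d l)))) ⟩
      (S j (λ l → y ^ (j ℕ.+ (d ℕ.+ l))) + S d (λ l → y ^ (j ℕ.+ l))) * P
        ≈⟨ *-congʳ (trans (+-comm _ _) (sym (S-split d j (λ l → y ^ (j ℕ.+ l))))) ⟩
      S (d ℕ.+ j) (λ l → y ^ (j ℕ.+ l)) * P
        ≡⟨ ≡.cong (λ k → S k (λ l → y ^ (j ℕ.+ l)) * P) (≡.trans (ℕ.+-comm d j) (≡.sym 1+m≡j+d)) ⟩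
      S (suc m) (λ l → y ^ (j ℕ.+ l)) * P
        ≈⟨ *-congʳ (trans (S-cong (suc m) λ l → ^-homo-* y j l) (S-*ˡ (suc m) (y ^ j) (y ^_))) ⟩
      (y ^ j * S (suc m) (y ^_)) * P
        ≈⟨ solve 3 (λ a b c → (a :* b) :* c := a :* (c :* b)) refl (y ^ j) (S (suc m) (y ^_)) P ⟩
      y ^ j * (P * S (suc m) (y ^_))
        -- Two of the signs in `e ^ suc (suc m)` cancel, so the base is `y`.
        ≈⟨ *-cong (^-congˡ j (*-congʳ (sym (cancel-e (e ^ m))))) (sym (product-last m f)) ⟩
      (e ^ suc (suc m) * x) ^ j * product {suc m} (f ∘ toℕ)
        ∎
      where
      as : List (Fin n)
      as = List.allFin n
      f : ℕ → Carrier
      f i = S (suc i) ((e ^ i * x) ^_)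
      y P : Carrier
      y = e ^ m * x
      P = product {m} (f ∘ toℕ)
      K above : Fin n → ℕ
      K a = if t <ᵇ suc (toℕ a) then suc m else 0
      above a = cardinality (λ b → U b ∧ (toℕ a <ᵇ toℕ b))
      j d : ℕ
      j = cardinality (λ a → U a ∧ (t <ᵇ suc (toℕ a)))
      d = cardinality (λ a → U a ∧ not (t <ᵇ suc (toℕ a)))
      1+m≡j+d : suc m ≡ j ℕ.+ d
      1+m≡j+d = ≡.trans (≡.sym ∣U∣≡k) (cardinality-split U (λ a → t <ᵇ suc (toℕ a)))
      -- A descent at the last position, `suc m`, contributes a power of `x` that can equally be
      -- read as a power of `y`.
      x^K≈y^K : ∀ a → x ^ K a ≈ y ^ K a
      x^K≈y^K a with t <ᵇ suc (toℕ a)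
      ... | true  = sym ([e^m*x]^[1+m] m)
      ... | false = refl
      above-∖ : ∀ {a} → U a ≡ true → above a ≡ cardinality (λ b → (U ∖ a) b ∧ (toℕ a <ᵇ toℕ b))
      above-∖ {a} Ua = ≡.trans (cardinality-remove U (λ b → toℕ a <ᵇ toℕ b) Ua)
        (≡.cong (λ b → toNat b ℕ.+ cardinality (λ b → (U ∖ a) b ∧ (toℕ a <ᵇ toℕ b))) (dec-false (a Fin.<? a) (ℕ.<-irrefl ≡.refl)))
      weight : ∀ {a} → U a ≡ true → ∀ u → distinctIn (U ∖ a) u ≡ true →
        e ^ inv (u ∷ʳ a) * x ^ majTo 1 t (u ∷ʳ a)
          ≈ (e ^ above a * x ^ K a) * (e ^ inv u * x ^ majTo 1 (suc (toℕ a)) u)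
      weight {a} Ua u distinct
        rewrite inv-∷ʳ u a | majTo-∷ʳ 1 t u a | above-∖ Ua
              | count-distinctIn (a Fin.<?_) (U ∖ a) u
                  (ℕ.suc-injective (≡.trans (≡.sym (cardinality-∖ U Ua)) ∣U∣≡k)) distinct = begin
        e ^ (J ℕ.+ inv u) * x ^ (M ℕ.+ K a)            ≈⟨ *-cong (^-homo-* e J (inv u)) (^-homo-* x M (K a)) ⟩
        (e ^ J * e ^ inv u) * (x ^ M * x ^ K a)        ≈⟨ solve 4 (λ a b c d → (a :* b) :* (c :* d) := (a :* d) :* (b :* c)) refl
                                                            (e ^ J) (e ^ inv u) (x ^ M) (x ^ K a) ⟩
        (e ^ J * x ^ K a) * (e ^ inv u * x ^ M)        ∎
        where
        J M : ℕ
        J = cardinality (λ b → (U ∖ a) b ∧ (toℕ a <ᵇ toℕ b))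
        M = majTo 1 (suc (toℕ a)) u
      lastLetter : ∀ a →
        ∑ (vectors as m) (λ u → 𝟙 (distinctIn U (u ∷ʳ a)) * (e ^ inv (u ∷ʳ a) * x ^ majTo 1 t (u ∷ʳ a)))
          ≈ (𝟙 (U a) * y ^ (K a ℕ.+ above a)) * P
      lastLetter a = begin
        ∑ (vectors as m) (λ u → 𝟙 (distinctIn U (u ∷ʳ a)) * (e ^ inv (u ∷ʳ a) * x ^ majTo 1 t (u ∷ʳ a)))
          ≈⟨ ∑-cong (vectors as m) (λ u → trans (*-congʳ (trans (reflexive (≡.cong 𝟙 (distinctIn-∷ʳ U u a)))
               (𝟙-∧ (U a) (distinctIn (U ∖ a) u)))) (*-assoc _ _ _)) ⟩
        ∑ (vectors as m) (λ u → 𝟙 (U a) * (𝟙 (distinctIn (U ∖ a) u) * (e ^ inv (u ∷ʳ a) * x ^ majTo 1 t (u ∷ʳ a))))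
          ≈⟨ ∑-*ˡ _ (vectors as m) _ ⟩
        𝟙 (U a) * ∑ (vectors as m) (λ u → 𝟙 (distinctIn (U ∖ a) u) * (e ^ inv (u ∷ʳ a) * x ^ majTo 1 t (u ∷ʳ a)))
          ≈⟨ 𝟙-*-cong (U a) chosen ⟩
        𝟙 (U a) * (y ^ (K a ℕ.+ above a) * P)
          ≈⟨ *-assoc _ _ _ ⟨
        (𝟙 (U a) * y ^ (K a ℕ.+ above a)) * P
          ∎
        where
        chosen : U a ≡ true →
          ∑ (vectors as m) (λ u → 𝟙 (distinctIn (U ∖ a) u) * (e ^ inv (u ∷ʳ a) * x ^ majTo 1 t (u ∷ʳ a)))
            ≈ y ^ (K a ℕ.+ above a) * P
        chosen Ua = begin
          ∑ (vectors as m) (λ u → 𝟙 (distinctIn (U ∖ a) u) * (e ^ inv (u ∷ʳ a) * x ^ majTo 1 t (u ∷ʳ a)))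
            ≈⟨ ∑-cong (vectors as m) (λ u → trans (𝟙-*-cong (distinctIn (U ∖ a) u) (weight Ua u))
                 (solve 3 (λ a b c → a :* (b :* c) := b :* (a :* c)) refl
                   (𝟙 (distinctIn (U ∖ a) u)) (e ^ above a * x ^ K a) (e ^ inv u * x ^ majTo 1 (suc (toℕ a)) u))) ⟩
          ∑ (vectors as m) (λ u → (e ^ above a * x ^ K a) * (𝟙 (distinctIn (U ∖ a) u) * (e ^ inv u * x ^ majTo 1 (suc (toℕ a)) u)))
            ≈⟨ ∑-*ˡ _ (vectors as m) _ ⟩
          (e ^ above a * x ^ K a) * ∑ (vectors as m) (λ u → 𝟙 (distinctIn (U ∖ a) u) * (e ^ inv u * x ^ majTo 1 (suc (toℕ a)) u))
            ≈⟨ *-congˡ (arrangement-sum m (U ∖ a) (suc (toℕ a))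
                 (ℕ.suc-injective (≡.trans (≡.sym (cardinality-∖ U Ua)) ∣U∣≡k))) ⟩
          (e ^ above a * x ^ K a) * ((e ^ suc m * x) ^ cardinality (λ b → (U ∖ a) b ∧ (toℕ a <ᵇ toℕ b)) * P)
            ≡⟨ ≡.cong (λ j → (e ^ above a * x ^ K a) * ((e ^ suc m * x) ^ j * P)) (≡.sym (above-∖ Ua)) ⟩
          (e ^ above a * x ^ K a) * ((e ^ suc m * x) ^ above a * P)
            ≈⟨ solve 4 (λ a b c d → (a :* b) :* (c :* d) := (b :* (a :* c)) :* d) refl
                 (e ^ above a) (x ^ K a) ((e ^ suc m * x) ^ above a) P ⟩
          (x ^ K a * (e ^ above a * (e ^ suc m * x) ^ above a)) * P
            -- Each letter above `a` brings one sign from its inversion with `a` and `e ^ suc m * x`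
            -- from the induction hypothesis; their product is `y`.
            ≈⟨ *-congʳ (*-cong (x^K≈y^K a) (trans (sym (^-distrib-* e (e ^ suc m * x) (above a)))
                 (^-congˡ (above a) (trans (*-congˡ (*-assoc e (e ^ m) x)) (cancel-e y))))) ⟩
          (y ^ K a * y ^ above a) * P
            ≈⟨ *-congʳ (^-homo-* y (K a) (above a)) ⟨
          y ^ (K a ℕ.+ above a) * P
            ∎

    -- The Gessel-Simion formula: all letters are used, and the threshold `n` lies above every one,
    -- so the extra power in `arrangement-sum` is trivial.
    signed-mahonian : ∀ n →
      ∑ (vectors (List.allFin n) n) (λ w → 𝟙 (does (isPermutation? w)) * (e ^ inv w * x ^ maj w))
        ≈ product {n} (λ i → S (suc (toℕ i)) ((e ^ toℕ i * x) ^_))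
    signed-mahonian n = begin
      ∑ (vectors (List.allFin n) n) (λ w → 𝟙 (does (isPermutation? w)) * (e ^ inv w * x ^ maj w))
        ≈⟨ ∑-cong (vectors (List.allFin n) n) (λ w → *-cong
             (reflexive (≡.cong 𝟙 (isPermutation-distinctIn w)))
             (*-congˡ (^-congʳ x (≡.sym (majTo-max 1 w))))) ⟩
      ∑ (vectors (List.allFin n) n) (λ w → 𝟙 (distinctIn (λ _ → true) w) * (e ^ inv w * x ^ majTo 1 n w))
        ≈⟨ arrangement-sum n (λ _ → true) n (cardinality-full n) ⟩
      (e ^ suc n * x) ^ cardinality {n} (λ a → n <ᵇ suc (toℕ a)) * P
        ≈⟨ *-congʳ (^-congʳ (e ^ suc n * x) (≡.trans (cardinality-cong {n} <ᵇ-toℕ) (cardinality-empty n))) ⟩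
      1# * P
        ≈⟨ *-identityˡ P ⟩
      P
        ∎
      where
      P : Carrier
      P = product {n} (λ i → S (suc (toℕ i)) ((e ^ toℕ i * x) ^_))

    -- Each color factor joins the matching Gessel-Simion factor by `S-*`. The function `p` stands
    -- for the sign powers as the statement writes them, with the integer power taken before passing
    -- to constants; these equal `e ^ k` only up to `≈`.
    signed-G*-sum : (p : ℕ → Carrier) → (∀ k → p k ≈ e ^ k) → ∀ r m .{{_ : NonZero r}} →
      ∑ (G* r (suc m)) (λ π → p (inv ∣ π ∣) * x ^ Dmaj π)
        ≈ product {m} (λ i → S (suc (toℕ i) ℕ.* r) ((p (toℕ i) * x) ^_)) * S (suc m) ((p m * x) ^_)
    signed-G*-sum p p≈e^ r m = begin
      ∑ (G* r (suc m)) (λ π → p (inv ∣ π ∣) * x ^ Dmaj π)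
        ≈⟨ ∑-cong (G* r (suc m)) (λ π → *-congʳ (p≈e^ (inv ∣ π ∣))) ⟩
      ∑ (G* r (suc m)) (λ π → e ^ inv ∣ π ∣ * x ^ Dmaj π)
        ≈⟨ G*-sum x r m (λ w → e ^ inv w) ⟩
      ∑ (vectors (List.allFin (suc m)) (suc m)) (λ w → 𝟙 (does (isPermutation? w)) * (e ^ inv w * x ^ maj w)) * P
        -- There is one color factor fewer than there are letters, so the last factor `f m` is set
        -- apart and stays unpaired.
        ≈⟨ *-congʳ (trans (signed-mahonian (suc m)) (product-last m f)) ⟩
      (product {m} (λ i → f (toℕ i)) * f m) * P
        ≈⟨ solve 3 (λ a b c → (a :* b) :* c := (a :* c) :* b) refl (product {m} (λ i → f (toℕ i))) (f m) P ⟩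
      (product {m} (λ i → f (toℕ i)) * P) * f m
        ≈⟨ *-congʳ (sym (product-distrib-* {m} (λ i → f (toℕ i)) _)) ⟩
      product {m} (λ i → f (toℕ i) * S r ((x ^ suc (toℕ i)) ^_)) * f m
        ≈⟨ *-cong (product-cong {m} λ i → factor (toℕ i)) (p-power (suc m) m) ⟩
      product {m} (λ i → S (suc (toℕ i) ℕ.* r) ((p (toℕ i) * x) ^_)) * S (suc m) ((p m * x) ^_)
        ∎
      where
      f : ℕ → Carrier
      f i = S (suc i) ((e ^ i * x) ^_)
      P : Carrier
      P = product {m} (λ i → S r ((x ^ suc (toℕ i)) ^_))
      p-power : ∀ k i → S k ((e ^ i * x) ^_) ≈ S k ((p i * x) ^_)
      p-power k i = S-cong k λ l → ^-congˡ l (*-congʳ (sym (p≈e^ i)))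
      factor : ∀ i → f i * S r ((x ^ suc i) ^_) ≈ S (suc i ℕ.* r) ((p i * x) ^_)
      factor i = begin
        f i * S r ((x ^ suc i) ^_)                ≈⟨ *-congˡ (S-cong r λ k → ^-congˡ k ([e^m*x]^[1+m] i)) ⟨
        f i * S r (((e ^ i * x) ^ suc i) ^_)      ≈⟨ S-* (e ^ i * x) (suc i) r ⟨
        S (r ℕ.* suc i) ((e ^ i * x) ^_)          ≡⟨ ≡.cong (λ k → S k ((e ^ i * x) ^_)) (ℕ.*-comm r (suc i)) ⟩
        S (suc i ℕ.* r) ((e ^ i * x) ^_)          ≈⟨ p-power (suc i ℕ.* r) i ⟩
        S (suc i ℕ.* r) ((p i * x) ^_)            ∎

open import Defs

-- Integer polynomials as a commutative semiring.

module Polynomials where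
  open ≡ using (refl; sym; trans; cong; cong₂; module ≡-Reasoning)

  coeff-+ : ∀ f g k → coeff (f + g) k ≡ coeff f k ℤ.+ coeff g k
  coeff-+ []      g       k       = sym (ℤ.+-identityˡ _)
  coeff-+ (a ∷ f) []      k       = sym (ℤ.+-identityʳ _)
  coeff-+ (a ∷ f) (b ∷ g) zero    = refl
  coeff-+ (a ∷ f) (b ∷ g) (suc k) = coeff-+ f g k

  coeff-map : ∀ a f k → coeff (List.map (a ℤ.*_) f) k ≡ a ℤ.* coeff f k
  coeff-map a []      k       = sym (ℤ.*-zeroʳ a)
  coeff-map a (b ∷ f) zero    = refl
  coeff-map a (b ∷ f) (suc k) = coeff-map a f k

  coeff-∷-* : ∀ a f g k → coeff ((a ∷ f) * g) k ≡ a ℤ.* coeff g k ℤ.+ coeff (0ℤ ∷ f * g) k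
  coeff-∷-* a f g k = trans (coeff-+ (List.map (a ℤ.*_) g) (0ℤ ∷ f * g) k) (cong (ℤ._+ _) (coeff-map a g k))

  ∷-cong : ∀ {a b f g} → a ≡ b → f ≈ g → a ∷ f ≈ b ∷ g
  ∷-cong a≡b f≈g zero    = a≡b
  ∷-cong a≡b f≈g (suc k) = f≈g k

  +-cong : ∀ {f f′ g g′} → f ≈ f′ → g ≈ g′ → f + g ≈ f′ + g′
  +-cong {f} {f′} {g} {g′} f≈f′ g≈g′ k = begin
    coeff (f + g) k               ≡⟨ coeff-+ f g k ⟩
    coeff f k ℤ.+ coeff g k       ≡⟨ cong₂ ℤ._+_ (f≈f′ k) (g≈g′ k) ⟩
    coeff f′ k ℤ.+ coeff g′ k     ≡⟨ coeff-+ f′ g′ k ⟨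
    coeff (f′ + g′) k             ∎
    where open ≡-Reasoning

  +-0∷-congˡ : ∀ h f g → f ≈ g → h + (0ℤ ∷ f) ≈ h + (0ℤ ∷ g)
  +-0∷-congˡ h f g f≈g = +-cong {h} {h} {0ℤ ∷ f} {0ℤ ∷ g} (λ _ → refl) (∷-cong refl f≈g)

  +-assoc : ∀ f g h → (f + g) + h ≈ f + (g + h)
  +-assoc f g h k rewrite coeff-+ (f + g) h k | coeff-+ f g k | coeff-+ f (g + h) k | coeff-+ g h k =
    ℤ.+-assoc (coeff f k) (coeff g k) (coeff h k)

  +-comm : ∀ f g → f + g ≈ g + f
  +-comm f g k rewrite coeff-+ f g k | coeff-+ g f k = ℤ.+-comm (coeff f k) (coeff g k)

  +-identityʳ : ∀ f → f + [] ≈ f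
  +-identityʳ []      k = refl
  +-identityʳ (a ∷ f) k = refl

  *-congˡ : ∀ f {g g′} → g ≈ g′ → f * g ≈ f * g′
  *-congˡ []      g≈g′ k = refl
  *-congˡ (a ∷ f) {g} {g′} g≈g′ k
    rewrite coeff-∷-* a f g k | coeff-∷-* a f g′ k | g≈g′ k =
    cong (λ c → a ℤ.* coeff g′ k ℤ.+ c) (∷-cong refl (*-congˡ f g≈g′) k)

  *-zeroʳ : ∀ f → f * [] ≈ []
  *-zeroʳ []      k       = refl
  *-zeroʳ (a ∷ f) zero    = refl
  *-zeroʳ (a ∷ f) (suc k) = *-zeroʳ f k

  -- The mirror image of the defining recursion of `_*_`, from which commutativity follows by
  -- induction.
  *-∷ : ∀ f b g → f * (b ∷ g) ≈ List.map (b ℤ.*_) f + (0ℤ ∷ f * g)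
  *-∷ []      b g zero    = refl
  *-∷ []      b g (suc k) = refl
  *-∷ (a ∷ f) b g zero    = cong (ℤ._+ 0ℤ) (ℤ.*-comm a b)
  *-∷ (a ∷ f) b g (suc k) = begin
    coeff (List.map (a ℤ.*_) g + f * (b ∷ g)) k                    ≡⟨ coeff-+ (List.map (a ℤ.*_) g) _ k ⟩
    A ℤ.+ coeff (f * (b ∷ g)) k                                    ≡⟨ cong (ℤ._+_ A) (trans (*-∷ f b g k) (coeff-+ (List.map (b ℤ.*_) f) _ k)) ⟩
    A ℤ.+ (B ℤ.+ C)                                                ≡⟨ swap A B C ⟩
    B ℤ.+ (A ℤ.+ C)                                                ≡⟨ cong (ℤ._+_ B) (coeff-+ (List.map (a ℤ.*_) g) _ k) ⟨
    B ℤ.+ coeff ((a ∷ f) * g) k                                    ≡⟨ coeff-+ (List.map (b ℤ.*_) f) _ k ⟨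
    coeff (List.map (b ℤ.*_) f + (a ∷ f) * g) k                    ∎
    where
    open ≡-Reasoning
    A B C : ℤ
    A = coeff (List.map (a ℤ.*_) g) k
    B = coeff (List.map (b ℤ.*_) f) k
    C = coeff (0ℤ ∷ f * g) k
    swap : ∀ a b c → a ℤ.+ (b ℤ.+ c) ≡ b ℤ.+ (a ℤ.+ c)
    swap = ℤ.solve-∀

  *-comm : ∀ f g → f * g ≈ g * f
  *-comm []      g k = sym (*-zeroʳ g k)
  *-comm (a ∷ f) g k = begin
    coeff (List.map (a ℤ.*_) g + (0ℤ ∷ f * g)) k   ≡⟨ +-0∷-congˡ (List.map (a ℤ.*_) g) (f * g) (g * f) (*-comm f g) k ⟩
    coeff (List.map (a ℤ.*_) g + (0ℤ ∷ g * f)) k   ≡⟨ *-∷ g a f k ⟨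
    coeff (g * (a ∷ f)) k                          ∎
    where open ≡-Reasoning

  -- Equal polynomials may be lists of different lengths, so the left factor is changed by way of
  -- commutativity rather than by recursion on it.
  *-cong : ∀ {f f′ g g′} → f ≈ f′ → g ≈ g′ → f * g ≈ f′ * g′
  *-cong {f} {f′} {g} {g′} f≈f′ g≈g′ k = begin
    coeff (f * g) k     ≡⟨ *-congˡ f g≈g′ k ⟩
    coeff (f * g′) k    ≡⟨ *-comm f g′ k ⟩
    coeff (g′ * f) k    ≡⟨ *-congˡ g′ f≈f′ k ⟩
    coeff (g′ * f′) k   ≡⟨ *-comm g′ f′ k ⟩
    coeff (f′ * g′) k   ∎
    where open ≡-Reasoning

  *-distribʳ-+ : ∀ h f g → (f + g) * h ≈ f * h + g * h
  *-distribʳ-+ h []      g       k = refl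
  *-distribʳ-+ h (a ∷ f) []      k = sym (+-identityʳ ((a ∷ f) * h) k)
  *-distribʳ-+ h (a ∷ f) (b ∷ g) k
    rewrite coeff-+ ((a ∷ f) * h) ((b ∷ g) * h) k
          | coeff-∷-* (a ℤ.+ b) (f + g) h k | coeff-∷-* a f h k | coeff-∷-* b g h k
          | ∷-cong {0ℤ} {0ℤ} {(f + g) * h} {f * h + g * h} refl (*-distribʳ-+ h f g) k
          | coeff-+ (0ℤ ∷ f * h) (0ℤ ∷ g * h) k =
    regroup a b (coeff h k) (coeff (0ℤ ∷ f * h) k) (coeff (0ℤ ∷ g * h) k)
    where
    regroup : ∀ a b c d e →
      (a ℤ.+ b) ℤ.* c ℤ.+ (d ℤ.+ e) ≡ a ℤ.* c ℤ.+ d ℤ.+ (b ℤ.* c ℤ.+ e)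
    regroup = ℤ.solve-∀

  map-*-assoc : ∀ a f g → List.map (a ℤ.*_) f * g ≈ List.map (a ℤ.*_) (f * g)
  map-*-assoc a []      g k = refl
  map-*-assoc a (b ∷ f) g k
    rewrite coeff-∷-* (a ℤ.* b) (List.map (a ℤ.*_) f) g k | coeff-map a ((b ∷ f) * g) k | coeff-∷-* b f g k
          | ∷-cong {0ℤ} {a ℤ.* 0ℤ} {List.map (a ℤ.*_) f * g} {List.map (a ℤ.*_) (f * g)} (sym (ℤ.*-zeroʳ a)) (map-*-assoc a f g) k | coeff-map a (0ℤ ∷ f * g) k =
    regroup a b (coeff g k) (coeff (0ℤ ∷ f * g) k)
    where
    regroup : ∀ a b c d → a ℤ.* b ℤ.* c ℤ.+ a ℤ.* d ≡ a ℤ.* (b ℤ.* c ℤ.+ d)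
    regroup = ℤ.solve-∀

  0∷-* : ∀ f g → (0ℤ ∷ f) * g ≈ 0ℤ ∷ f * g
  0∷-* f g k rewrite coeff-∷-* 0ℤ f g k = ℤ.+-identityˡ _

  *-assoc : ∀ f g h → (f * g) * h ≈ f * (g * h)
  *-assoc []      g h k = refl
  *-assoc (a ∷ f) g h k = begin
    coeff ((List.map (a ℤ.*_) g + (0ℤ ∷ f * g)) * h) k                ≡⟨ *-distribʳ-+ h (List.map (a ℤ.*_) g) (0ℤ ∷ f * g) k ⟩
    coeff (List.map (a ℤ.*_) g * h + (0ℤ ∷ f * g) * h) k              ≡⟨ +-cong {List.map (a ℤ.*_) g * h} {List.map (a ℤ.*_) (g * h)} {(0ℤ ∷ f * g) * h} {0ℤ ∷ f * g * h}
                                                                            (map-*-assoc a g h) (0∷-* (f * g) h) k ⟩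
    coeff (List.map (a ℤ.*_) (g * h) + (0ℤ ∷ f * g * h)) k            ≡⟨ +-0∷-congˡ (List.map (a ℤ.*_) (g * h)) (f * g * h) (f * (g * h)) (*-assoc f g h) k ⟩
    coeff (List.map (a ℤ.*_) (g * h) + (0ℤ ∷ f * (g * h))) k          ∎
    where open ≡-Reasoning

  *-identityˡ : ∀ f → const 1ℤ * f ≈ f
  *-identityˡ f k rewrite coeff-∷-* 1ℤ [] f k | ℤ.*-identityˡ (coeff f k) = lemma k
    where
    lemma : ∀ k → coeff f k ℤ.+ coeff (0ℤ ∷ []) k ≡ coeff f k
    lemma zero    = ℤ.+-identityʳ _
    lemma (suc k) = ℤ.+-identityʳ _

  -- Its operations are those of `ℤ[q]`, so sums, products and powers formed in it are the ones in
  -- the statement.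
  commutativeSemiring : CommutativeSemiring 0ℓ 0ℓ
  commutativeSemiring = record
    { Carrier = Poly
    ; _≈_     = _≈_
    ; _+_     = _+_
    ; _*_     = _*_
    ; 0#      = []
    ; 1#      = const 1ℤ
    ; isCommutativeSemiring = isCommutativeSemiringˡ record
      { +-isCommutativeMonoid = record
        { isMonoid = record
          { isSemigroup = record
            { isMagma = record
              { isEquivalence = isEquivalence
              ; ∙-cong = λ {f} {f′} {g} {g′} → +-cong {f} {f′} {g} {g′}
              }
            ; assoc = +-assoc
            }
          ; identity = (λ f k → refl) , +-identityʳ
          }
        ; comm = +-comm
        }
      ; *-isCommutativeMonoid = record
        { isMonoid = record
          { isSemigroup = record
            { isMagma = record
              { isEquivalence = isEquivalence
              ; ∙-cong = λ {f} {f′} {g} {g′} → *-cong {f} {f′} {g} {g′}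
              }
            ; assoc = *-assoc
            }
          ; identity = *-identityˡ , λ f k → trans (*-comm f (const 1ℤ) k) (*-identityˡ f k)
          }
        ; comm = *-comm
        }
      ; distribʳ = *-distribʳ-+
      ; zeroˡ = λ f k → refl
      }
    }
    where
    isEquivalence : IsEquivalence _≈_
    isEquivalence = record
      { refl  = λ k → refl
      ; sym   = λ f≈g k → sym (f≈g k)
      ; trans = λ f≈g g≈h k → trans (f≈g k) (g≈h k)
      }

  -- Signs as constant polynomials.

  const-* : ∀ a b → const (a ℤ.* b) ≈ const a * const b
  const-* a b zero    = sym (ℤ.+-identityʳ (a ℤ.* b))
  const-* a b (suc k) = refl

  const-^ : ∀ a k → const (a ℤ.^ k) ≈ const a ^ k
  const-^ a zero    j = refl
  const-^ a (suc k) j = trans (const-* a (a ℤ.^ k) j) (*-congˡ (const a) {const (a ℤ.^ k)} {const a ^ k} (const-^ a k) j)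

  const-involutive : ∀ {ε} → ε ≡ 1ℤ ⊎ ε ≡ -1ℤ → const ε * const ε ≈ const 1ℤ
  const-involutive (inj₁ refl) zero    = refl
  const-involutive (inj₁ refl) (suc k) = refl
  const-involutive (inj₂ refl) zero    = refl
  const-involutive (inj₂ refl) (suc k) = refl

theorem6p1 : (r n : ℕ) .{{_ : NonZero r}} .{{_ : NonZero n}} →
    (ε : ℤ) → (ε ≡ 1ℤ ⊎ ε ≡ -1ℤ) →
    ((w : Vec (Fin n) n) → IsPermutation w →
    ∑ (G*⟨ w ⟩ r) (λ π → const (ε ℤ.^ inv ∣ π ∣) * q ^ Dmaj π)
    ≈ const (ε ℤ.^ inv w) * q ^ maj w
    * product {n ∸ 1} (λ i → [ r ]⟨ q ^ suc (toℕ i) ⟩))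
    ×
    (∑ (G* r n) (λ π → const (ε ℤ.^ inv ∣ π ∣) * q ^ Dmaj π)
    ≈ product {n ∸ 1} (λ i → [ suc (toℕ i) ℕ.* r ]⟨ const (ε ℤ.^ toℕ i) * q ⟩)
    * [ n ]⟨ const (ε ℤ.^ (n ∸ 1)) * q ⟩)
theorem6p1 r zero    ε ε≡±1 = contradiction ≡.refl (ℕ.≢-nonZero⁻¹ 0)
-- For n = `suc m` the truncated `n ∸ 1` reduces to `m`, and both identities hold by instantiation
-- at polynomials.
theorem6p1 r (suc m) ε ε≡±1 =
  G*⟨⟩-sum q r m (λ w → const (ε ℤ.^ inv w)) ,
  signed-G*-sum (const ε) q (const-involutive ε≡±1) (λ k → const (ε ℤ.^ k)) (const-^ ε) r m
  where
  open Polynomials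
  open WeightedSums commutativeSemiring
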